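{- Let $n,m,k$ be positive integers with $k\le n$ and $k\le m$. The number of standard Young tableaux of truncated straight shape $n^m\setminus(k^{k-1},k-1)$ is $$\binom{nm-k^2+1}{m(n-k)}\binom{k(m+n-2k)+1}{kn-k^2}^{ -1}f_{(m^{n-k})}\,f_{((m-k)^{k})}.$$
   Context: For integer partitions $\lambda,\mu$ with $\lambda_i\ge\mu_i$ for all $i$ (with $\mu_i=0$ beyond the length of $\mu$), the straight diagram of truncated shape $\lambda\setminus\mu$ is the left-justified array of boxes whose row $i$ (counted from the top) has $\lambda_i-\mu_i$ boxes. The notation $a^b$ in a partition means that the part $a$ is repeated $b$ times. So $n^m\setminus(k^{k-1},k-1)$ has $m$ rows: the first $k-1$ rows have length $n-k$, the $k$-th row has length $n-k+1$, and the remaining rows have length $n$ (a rectangle truncated by a $k\times k$ square minus one box). A standard Young tableau of such a shape with $N$ boxes is a filling of the boxes with $1,\ldots,N$, each used exactly once, with entries increasing along rows and down columns. $f_\lambda$ denotes the number of standard Young tableaux of ordinary straight shape $\lambda$ (equal to $1$ for the empty shape). -}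

module Defs where

open import Data.Fin.Base as Fin using (Fin; toℕ)
import Data.Fin.Properties as Fin
open import Data.List.Base as List
  using (List; []; _∷_; [_]; allFin; cartesianProductWith; filter; length)
open import Data.List.Membership.Propositional using (_∈_)
open import Data.List.Membership.Propositional.Properties
  using (∈-allFin; ∈-cartesianProductWith⁺; ∈-filter⁺; ∈-filter⁻)
open import Data.List.Relation.Unary.All as All using (All; []; _∷_)
open import Data.List.Relation.Unary.AllPairs using ([]; _∷_)
open import Data.List.Relation.Unary.Any using (here)
open import Data.List.Relation.Unary.Unique.Propositional using (Unique)
import Data.List.Relation.Unary.Unique.Propositional.Properties as Unique
open import Data.Nat.Base
open import Data.Nat.Combinatorics using (_C_; nCk≡n!/k![n-k]!; k![n∸k]!∣n!)
open import Data.Nat.Divisibility using (∣⇒≤)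
open import Data.Nat.ListAction using (sum)
open import Data.Nat.DivMod using (m≥n⇒m/n>0)
import Data.Nat.Properties as ℕ
open import Data.Product.Base using (∃; _×_; _,_; proj₁; proj₂)
open import Data.Product.Properties using (≡-dec)
open import Data.Vec.Base as Vec using (Vec; []; _∷_)
open import Function.Definitions using (Bijective)
open import Level using (0ℓ)
open import Relation.Binary.PropositionalEquality
  using (_≡_; refl; sym; cong; subst)
open import Relation.Nullary using (Dec)
open import Relation.Nullary.Decidable using (map′; _×-dec_; _→-dec_)
open import Relation.Unary using (Pred; Decidable)

-- A left-justified array of boxes, given by its row lengths from the top
-- (empty rows allowed).  A partition is read as its ordinary diagram.

Shape : Set
Shape = List ℕ

-- The straight diagram of truncated shape λ∖μ.  Meaningful only when
-- μ ⊆ λ, in which case no monus below truncates.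

infix 5 _⧹_

_⧹_ : List ℕ → List ℕ → Shape
[]       ⧹ _        = []
(l ∷ ls) ⧹ []       = l ∷ ls
(l ∷ ls) ⧹ (m ∷ ms) = (l ∸ m) ∷ (ls ⧹ ms)

record Box (s : Shape) : Set where
  constructor box
  field
    row  : Fin (length s)
    col′ : Fin (List.lookup s row)

  col : ℕ
  col = toℕ col′

open Box public

-- Entries are taken in Fin N, N being the number of boxes; the element x
-- of Fin N stands for the entry suc (toℕ x) ∈ {1,…,N}.

FillingIn : ℕ → Shape → Set
FillingIn N = All (Vec (Fin N))

Filling : Shape → Set
Filling s = FillingIn (sum s) s

entry : ∀ {N s} → FillingIn N s → Box s → Fin N
entry (r ∷ _)  (box Fin.zero    j) = Vec.lookup r j
entry (_ ∷ rs) (box (Fin.suc i) j) = entry rs (box i j)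

record IsSYT {s : Shape} (T : Filling s) : Set where
  constructor isSYT
  field
    bijective : Bijective _≡_ _≡_ (entry T)
    rows      : ∀ (b c : Box s) → row b ≡ row c → col b < col c →
                entry T b Fin.< entry T c
    columns   : ∀ (b c : Box s) → col b ≡ col c → row b Fin.< row c →
                entry T b Fin.< entry T c

record Enumeration {A : Set} (P : Pred A 0ℓ) : Set where
  field
    list     : List A
    unique   : Unique list
    sound    : ∀ {x} → x ∈ list → P x
    complete : ∀ {x} → P x → x ∈ list

module _ {s : Shape} where

  allBox? : {P : Pred (Box s) 0ℓ} → Decidable P → Dec (∀ b → P b)
  allBox? P? = map′ (λ f (box i j) → f i j) (λ f i j → f (box i j))
    (Fin.all? λ i → Fin.all? λ j → P? (box i j))

  anyBox? : {P : Pred (Box s) 0ℓ} → Decidable P → Dec (∃ P)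
  anyBox? P? = map′ (λ (i , j , p) → box i j , p) (λ (box i j , p) → i , j , p)
    (Fin.any? λ i → Fin.any? λ j → P? (box i j))

  _≟Box_ : (b c : Box s) → Dec (b ≡ c)
  box i j ≟Box box i′ j′ = map′ (λ { refl → refl }) (λ { refl → refl })
    (≡-dec Fin._≟_ Fin._≟_ (i , j) (i′ , j′))

  bijective? : (T : Filling s) → Dec (Bijective _≡_ _≡_ (entry T))
  bijective? T = map′
    (λ (inj , sur) → (λ {b} {c} → inj b c) ,
                     (λ v → proj₁ (sur v) , λ { refl → proj₂ (sur v) }))
    (λ (inj , sur) → (λ b c → inj) , (λ v → proj₁ (sur v) , proj₂ (sur v) refl))
    ((allBox? λ b → allBox? λ c →
        (entry T b Fin.≟ entry T c) →-dec (b ≟Box c))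
     ×-dec
     (Fin.all? λ v → anyBox? λ b → entry T b Fin.≟ v))

  isSYT? : Decidable (IsSYT {s})
  isSYT? T = map′ (λ (x , y , z) → isSYT x y z) (λ (isSYT x y z) → x , y , z)
    (bijective? T
     ×-dec
     (allBox? λ b → allBox? λ c → (row b Fin.≟ row c) →-dec
        ((col b ℕ.<? col c) →-dec (entry T b Fin.<? entry T c)))
     ×-dec
     (allBox? λ b → allBox? λ c → (col b ℕ.≟ col c) →-dec
        ((row b Fin.<? row c) →-dec (entry T b Fin.<? entry T c))))

vecs : ∀ N r → List (Vec (Fin N) r)
vecs N zero    = [ [] ]
vecs N (suc r) = cartesianProductWith _∷_ (allFin N) (vecs N r)

vecs-unique : ∀ N r → Unique (vecs N r)
vecs-unique N zero    = [] ∷ []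
vecs-unique N (suc r) = Unique.cartesianProductWith⁺ _∷_ (λ { refl → refl , refl })
  (Unique.allFin⁺ N) (vecs-unique N r)

vecs-complete : ∀ {N r} (v : Vec (Fin N) r) → v ∈ vecs N r
vecs-complete []      = here refl
vecs-complete (x ∷ v) = ∈-cartesianProductWith⁺ _∷_ (∈-allFin x) (vecs-complete v)

fillings : ∀ N s → List (FillingIn N s)
fillings N []      = [ [] ]
fillings N (r ∷ s) = cartesianProductWith _∷_ (vecs N r) (fillings N s)

fillings-unique : ∀ N s → Unique (fillings N s)
fillings-unique N []      = [] ∷ []
fillings-unique N (r ∷ s) = Unique.cartesianProductWith⁺ _∷_ (λ { refl → refl , refl })
  (vecs-unique N r) (fillings-unique N s)

fillings-complete : ∀ {N s} (T : FillingIn N s) → T ∈ fillings N s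
fillings-complete []      = here refl
fillings-complete (v ∷ T) =
  ∈-cartesianProductWith⁺ _∷_ (vecs-complete v) (fillings-complete T)

SYTs : ∀ s → Enumeration (IsSYT {s})
SYTs s = record
  { list     = filter isSYT? (fillings (sum s) s)
  ; unique   = Unique.filter⁺ isSYT? (fillings-unique (sum s) s)
  ; sound    = λ T∈ → proj₂ (∈-filter⁻ isSYT? {xs = fillings (sum s) s} T∈)
  ; complete = λ {T} p → ∈-filter⁺ isSYT? (fillings-complete T) p
  }

#SYT : Shape → ℕ
#SYT s = length (Enumeration.list (SYTs s))

C-nonZero : ∀ {n k} → k ≤ n → NonZero (n C k)
C-nonZero {n} {k} k≤n = subst NonZero (sym (nCk≡n!/k![n-k]! k≤n))
  (>-nonZero (m≥n⇒m/n>0 (∣⇒≤ (k![n∸k]!∣n! k≤n))))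
  where instance
    _ = n ℕ.!≢0
    _ = k ℕ.!* (n ∸ k) !≢0

denominator-nonZero : ∀ {n m k} → k ≤ m →
  NonZero ((k * (m + n ∸ 2 * k) + 1) C (k * n ∸ k * k))
denominator-nonZero {n} {m} {k} k≤m = C-nonZero (begin
  k * n ∸ k * k             ≡⟨ ℕ.*-distribˡ-∸ k n k ⟨
  k * (n ∸ k)               ≡⟨ cong (k *_) (ℕ.[m+n]∸[m+o]≡n∸o k n k) ⟨
  k * (k + n ∸ (k + k))     ≡⟨ cong (λ x → k * (k + n ∸ (k + x))) (ℕ.+-identityʳ k) ⟨
  k * (k + n ∸ 2 * k)       ≤⟨ ℕ.*-monoʳ-≤ k (ℕ.∸-monoˡ-≤ (2 * k) (ℕ.+-monoˡ-≤ n k≤m)) ⟩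
  k * (m + n ∸ 2 * k)       ≤⟨ ℕ.m≤m+n _ 1 ⟩
  k * (m + n ∸ 2 * k) + 1   ∎)
  where open ℕ.≤-Reasoning

{-# OPTIONS --safe #-}

-- Cut a tableau at the box ending row k, the one missing from the removed k × k square.
-- The entries smaller than its entry form a partition (aᵏ, μ) with μ ⊆ aᵇ, where a = n - k
-- and b = m - k, and the larger ones fill the rest, so the number of tableaux is the sum
-- over μ of f(aᵏ, μ) times the number of ways to go from nᵇ down to μ by removing boxes.
-- In the coordinates lᵢ = μᵢ + b - i, the hook length formula turns each summand into a
-- function of |μ| alone times f(μ) times the number of ways from aᵇ down to μ.  The sum
-- over the μ of a given size is therefore a multiple of f(aᵇ), and the sum over sizes is
-- a Vandermonde convolution.

module Submission where

open import Defs
open import Data.Empty using (⊥; ⊥-elim)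
open import Data.Fin.Base as Fin using (Fin; toℕ; fromℕ; inject₁)
import Data.Fin.Properties as Fin
open import Data.Integer.Base as ℤ using (ℤ; +_; 0ℤ; 1ℤ; -1ℤ)
import Data.Integer.Properties as ℤ
open import Data.Integer.Tactic.RingSolver using (solve-∀)
open import Data.List.Base
  using (List; []; _∷_; [_]; _++_; map; concatMap; length; lookup; replicate)
open import Data.List.Membership.Propositional using (_∈_; lose; find)
open import Data.List.Membership.Propositional.Properties
  using (∈-map⁺; ∈-map⁻; ∈-concatMap⁺; ∈-concatMap⁻; ∈-lookup)
import Data.List.Properties as List
open import Data.List.Relation.Binary.Disjoint.Propositional using (Disjoint)
open import Data.List.Relation.Unary.All as All using (All; []; _∷_)
import Data.List.Relation.Unary.All.Properties as All
open import Data.List.Relation.Unary.AllPairs as AllPairs using (AllPairs; []; _∷_)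
import Data.List.Relation.Unary.AllPairs.Properties as AllPairs
open import Data.List.Relation.Unary.Any as Any using (Any; here; there)
import Data.List.Relation.Unary.Any.Properties as Any
open import Data.List.Relation.Unary.Unique.Propositional using (Unique)
import Data.List.Relation.Unary.Unique.Propositional.Properties as Unique
open import Data.Nat.Base as ℕ using (ℕ; zero; suc; _!; _≤_; _<_; _>_; z≤n; s≤s)
open import Data.Nat.DivMod using (m/n*n≡m)
open import Data.Nat.ListAction using (sum)
import Data.Nat.Properties as ℕ
import Data.Nat.Tactic.RingSolver as ℕ-Ring
open import Data.Product.Base using (∃; _×_; _,_; proj₁; proj₂)
open import Data.Rational.Base using (_/_)
import Data.Rational.Properties as ℚ
import Data.Rational.Unnormalised.Base as ℚᵘ
open import Data.Sum.Base using (_⊎_; inj₁; inj₂)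
open import Data.Vec.Base as Vec using (Vec; []; _∷_; _∷ʳ_)
import Data.Vec.Properties as Vec
open import Function.Base using (_∘_)
open import Relation.Binary.PropositionalEquality hiding ([_])
open import Relation.Nullary using (Dec; yes; no; ¬_; contradiction)

-- The ways from a rectangle down to `μ` are fillings of a skew shape, and these are never counted.
-- In their place stands `weight`, a product in the coordinates on which the adjoint of box removal
-- acts, level by level, as multiplication by the number of boxes that `μ` lacks to the rectangle.
-- Summing numbers of tableaux against it (`pairing`) turns the branching rule into a recurrence in
-- the size alone: a homogeneous one for `X`, one with source `Y` for `H`. Both the eigenvalue
-- property of `weight` and the hook length formula come from a single interpolation identity for
-- the Vandermonde product, used with step 1 and step -1. This product vanishes on a repeated entry,
-- so moves that leave the partitions contribute nothing, and sums may run over all lists of bounded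
-- entries. Every identity is multiplied out over ℤ; quotients enter only as cancellation of a
-- nonzero factor, and rationals only in the last statement.

⟦_⟧ : {P : Set} → Dec P → ℤ
⟦ yes _ ⟧ = 1ℤ
⟦ no _ ⟧  = 0ℤ

⟦⟧-yes : {P : Set} (P? : Dec P) → P → ⟦ P? ⟧ ≡ 1ℤ
⟦⟧-yes (yes _) p = refl
⟦⟧-yes (no ¬p) p = contradiction p ¬p

⟦⟧-no : {P : Set} (P? : Dec P) → ¬ P → ⟦ P? ⟧ ≡ 0ℤ
⟦⟧-no (yes p) ¬p = contradiction p ¬p
⟦⟧-no (no _)  ¬p = refl

⟦⟧-cong : {P Q : Set} (P? : Dec P) (Q? : Dec Q) → (P → Q) → (Q → P) → ⟦ P? ⟧ ≡ ⟦ Q? ⟧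
⟦⟧-cong (yes p) Q? f g = sym (⟦⟧-yes Q? (f p))
⟦⟧-cong (no ¬p) Q? f g = sym (⟦⟧-no Q? (¬p ∘ g))

-- Removable boxes

-- Only the rows below are constrained: the rows above may be shorter, as they are in a truncated
-- shape, and the box taken away still ends its row and its column.
data Removal : Shape → Shape → Set where
  top  : ∀ {y s} → All (_≤ y) s → Removal (suc y ∷ s) (y ∷ s)
  next : ∀ {y s t} → Removal s t → Removal (y ∷ s) (y ∷ t)

corner : ∀ {s t} → Removal s t → Box s
corner (top {y} _) = box Fin.zero (fromℕ y)
corner (next r)    = box (Fin.suc (row (corner r))) (col′ (corner r))

keep : ∀ {s t} → Removal s t → Box t → Box s
keep (top _)  (box Fin.zero j)    = box Fin.zero (inject₁ j)
keep (top _)  (box (Fin.suc i) j) = box (Fin.suc i) j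
keep (next r) (box Fin.zero j)    = box Fin.zero j
keep (next r) (box (Fin.suc i) j) =
  box (Fin.suc (row (keep r (box i j)))) (col′ (keep r (box i j)))

below : ∀ {y s} → Box s → Box (y ∷ s)
below (box i j) = box (Fin.suc i) j

toℕ-row-keep : ∀ {s t} (r : Removal s t) b → toℕ (row (keep r b)) ≡ toℕ (row b)
toℕ-row-keep (top _)  (box Fin.zero j)    = refl
toℕ-row-keep (top _)  (box (Fin.suc i) j) = refl
toℕ-row-keep (next r) (box Fin.zero j)    = refl
toℕ-row-keep (next r) (box (Fin.suc i) j) = cong suc (toℕ-row-keep r (box i j))

col-keep : ∀ {s t} (r : Removal s t) b → col (keep r b) ≡ col b
col-keep (top _)  (box Fin.zero j)    = Fin.toℕ-inject₁ j
col-keep (top _)  (box (Fin.suc i) j) = refl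
col-keep (next r) (box Fin.zero j)    = refl
col-keep (next r) (box (Fin.suc i) j) = col-keep r (box i j)

data BoxView {s t} (r : Removal s t) : Box s → Set where
  isCorner : BoxView r (corner r)
  isKept   : ∀ b → BoxView r (keep r b)

boxView : ∀ {s t} (r : Removal s t) (b : Box s) → BoxView r b
boxView (top {y} _) (box Fin.zero j) with y ℕ.≟ toℕ j
... | yes y≡j = subst (BoxView _) (cong (box Fin.zero)
        (Fin.toℕ-injective (trans (Fin.toℕ-fromℕ y) y≡j))) isCorner
... | no y≢j = subst (BoxView _) (cong (box Fin.zero) (Fin.inject₁-lower₁ j y≢j))
        (isKept (box Fin.zero (Fin.lower₁ j y≢j)))
boxView (top _) (box (Fin.suc i) j) = isKept (box (Fin.suc i) j)
boxView (next r) (box Fin.zero j) = isKept (box Fin.zero j)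
boxView (next r) (box (Fin.suc i) j) = go (boxView r (box i j))
  where
  go : ∀ {b} → BoxView r b → BoxView (next r) (below b)
  go isCorner         = isCorner
  go (isKept (box i j)) = isKept (box (Fin.suc i) j)

column-bounded : ∀ {y s} → All (_≤ y) s → (b : Box s) → col b < y
column-bounded all≤ (box i j) =
  ℕ.<-≤-trans (Fin.toℕ<n j) (All.lookup all≤ (∈-lookup i))

corner-last-in-row : ∀ {s t} (r : Removal s t) (b : Box t) →
  toℕ (row b) ≡ toℕ (row (corner r)) → col b < col (corner r)
corner-last-in-row (top {y} _) (box Fin.zero j) _
  rewrite Fin.toℕ-fromℕ y = Fin.toℕ<n j
corner-last-in-row (next r) (box (Fin.suc i) j) eq =
  corner-last-in-row r (box i j) (ℕ.suc-injective eq)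

corner-last-in-column : ∀ {s t} (r : Removal s t) (b : Box t) →
  col b ≡ col (corner r) → toℕ (row b) < toℕ (row (corner r))
corner-last-in-column (top {y} _) (box Fin.zero j) eq
  rewrite Fin.toℕ-fromℕ y = contradiction eq (ℕ.<⇒≢ (Fin.toℕ<n j))
corner-last-in-column (top {y} all≤) (box (Fin.suc i) j) eq
  rewrite Fin.toℕ-fromℕ y = contradiction eq (ℕ.<⇒≢ (column-bounded all≤ (box i j)))
corner-last-in-column (next r) (box Fin.zero j) eq = s≤s z≤n
corner-last-in-column (next r) (box (Fin.suc i) j) eq =
  s≤s (corner-last-in-column r (box i j) eq)

keep≢corner : ∀ {s t} (r : Removal s t) b → keep r b ≢ corner r
keep≢corner r b eq = ℕ.<⇒≢ (corner-last-in-row r b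
  (trans (sym (toℕ-row-keep r b)) (cong (toℕ ∘ row) eq)))
  (trans (sym (col-keep r b)) (cong col eq))

Box-≡ : ∀ {s} {b c : Box s} → toℕ (row b) ≡ toℕ (row c) → col b ≡ col c → b ≡ c
Box-≡ {b = box i j} {box i′ j′} p q with refl ← Fin.toℕ-injective p
  = cong (box i) (Fin.toℕ-injective q)

keep-injective : ∀ {s t} (r : Removal s t) {b c} → keep r b ≡ keep r c → b ≡ c
keep-injective r {b} {c} eq = Box-≡
  (trans (sym (toℕ-row-keep r b)) (trans (cong (toℕ ∘ row) eq) (toℕ-row-keep r c)))
  (trans (sym (col-keep r b)) (trans (cong col eq) (col-keep r c)))

-- Insertion of the largest entry

-- The number `N` of entries is an index of its own rather than `sum s`, so that insertion leads
-- from `N` to `suc N` without transport. Rows are compared through `toℕ` because the row indices of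
-- a shape and of its reduction have different types.
record Standard {N s} (T : FillingIn N s) : Set where
  constructor standard
  field
    injective  : ∀ b c → entry T b ≡ entry T c → b ≡ c
    surjective : ∀ v → ∃ λ b → entry T b ≡ v
    rows       : ∀ (b c : Box s) → toℕ (row b) ≡ toℕ (row c) → col b < col c →
                 entry T b Fin.< entry T c
    columns    : ∀ (b c : Box s) → col b ≡ col c → toℕ (row b) < toℕ (row c) →
                 entry T b Fin.< entry T c

raise : ∀ {N s} → FillingIn N s → FillingIn (suc N) s
raise []      = []
raise (v ∷ T) = Vec.map inject₁ v ∷ raise T

insert : ∀ {N s t} → Removal s t → FillingIn N t → FillingIn (suc N) s
insert (top _)  (v ∷ T) = (Vec.map inject₁ v ∷ʳ fromℕ _) ∷ raise T
insert (next r) (v ∷ T) = Vec.map inject₁ v ∷ insert r T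

lookup-∷ʳ-last : ∀ {A : Set} {n} (v : Vec A n) x → Vec.lookup (v ∷ʳ x) (fromℕ n) ≡ x
lookup-∷ʳ-last []      x = refl
lookup-∷ʳ-last (_ ∷ v) x = lookup-∷ʳ-last v x

lookup-∷ʳ-inject₁ : ∀ {A : Set} {n} (v : Vec A n) x i →
  Vec.lookup (v ∷ʳ x) (inject₁ i) ≡ Vec.lookup v i
lookup-∷ʳ-inject₁ (_ ∷ v) x Fin.zero    = refl
lookup-∷ʳ-inject₁ (_ ∷ v) x (Fin.suc i) = lookup-∷ʳ-inject₁ v x i

entry-raise : ∀ {N s} (T : FillingIn N s) b → entry (raise T) b ≡ inject₁ (entry T b)
entry-raise (v ∷ T) (box Fin.zero j)    = Vec.lookup-map j inject₁ v
entry-raise (v ∷ T) (box (Fin.suc i) j) = entry-raise T (box i j)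

entry-insert-corner : ∀ {N s t} (r : Removal s t) (T : FillingIn N t) →
  entry (insert r T) (corner r) ≡ fromℕ N
entry-insert-corner (top _)  (v ∷ T) = lookup-∷ʳ-last (Vec.map inject₁ v) _
entry-insert-corner (next r) (v ∷ T) = entry-insert-corner r T

entry-insert-keep : ∀ {N s t} (r : Removal s t) (T : FillingIn N t) b →
  entry (insert r T) (keep r b) ≡ inject₁ (entry T b)
entry-insert-keep (top _) (v ∷ T) (box Fin.zero j) =
  trans (lookup-∷ʳ-inject₁ (Vec.map inject₁ v) _ j) (Vec.lookup-map j inject₁ v)
entry-insert-keep (top _)  (v ∷ T) (box (Fin.suc i) j) = entry-raise T (box i j)
entry-insert-keep (next r) (v ∷ T) (box Fin.zero j)    = Vec.lookup-map j inject₁ v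
entry-insert-keep (next r) (v ∷ T) (box (Fin.suc i) j) = entry-insert-keep r T (box i j)

module _ {N s t} (r : Removal s t) (T : FillingIn N t) where

  private
    at-corner : entry (insert r T) (corner r) ≡ fromℕ N
    at-corner = entry-insert-corner r T

    at-keep : ∀ b → entry (insert r T) (keep r b) ≡ inject₁ (entry T b)
    at-keep = entry-insert-keep r T

    keep<corner : ∀ b → entry (insert r T) (keep r b) Fin.< entry (insert r T) (corner r)
    keep<corner b = subst₂ Fin._<_ (sym (at-keep b)) (sym at-corner)
      (subst (toℕ (inject₁ (entry T b)) <_) (sym (Fin.toℕ-fromℕ N)) (Fin.inject₁ℕ< _))

    keep<keep : ∀ b c → entry T b Fin.< entry T c →
      entry (insert r T) (keep r b) Fin.< entry (insert r T) (keep r c)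
    keep<keep b c lt = subst₂ Fin._<_ (sym (at-keep b)) (sym (at-keep c))
      (subst₂ _<_ (sym (Fin.toℕ-inject₁ _)) (sym (Fin.toℕ-inject₁ _)) lt)

    keep<keep⁻ : ∀ b c → entry (insert r T) (keep r b) Fin.< entry (insert r T) (keep r c) →
      entry T b Fin.< entry T c
    keep<keep⁻ b c lt = subst₂ _<_ (Fin.toℕ-inject₁ _) (Fin.toℕ-inject₁ _)
      (subst₂ Fin._<_ (at-keep b) (at-keep c) lt)

  insert-standard : Standard T → Standard (insert r T)
  insert-standard (standard inj sur rows cols) = standard inj′ sur′ rows′ cols′
    where
    inj′ : ∀ b c → entry (insert r T) b ≡ entry (insert r T) c → b ≡ c
    inj′ b c eq with boxView r b | boxView r c
    ... | isCorner | isCorner = refl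
    ... | isCorner | isKept c′ = contradiction
            (trans (sym at-corner) (trans eq (at-keep c′))) Fin.fromℕ≢inject₁
    ... | isKept b′ | isCorner = contradiction
            (trans (sym at-corner) (trans (sym eq) (at-keep b′))) Fin.fromℕ≢inject₁
    ... | isKept b′ | isKept c′ = cong (keep r) (inj b′ c′ (Fin.inject₁-injective
            (trans (sym (at-keep b′)) (trans eq (at-keep c′)))))

    sur′ : ∀ v → ∃ λ b → entry (insert r T) b ≡ v
    sur′ v with N ℕ.≟ toℕ v
    ... | yes N≡v = corner r , trans at-corner
            (Fin.toℕ-injective (trans (Fin.toℕ-fromℕ N) N≡v))
    ... | no N≢v with sur (Fin.lower₁ v N≢v)
    ... | b , eq = keep r b , trans (at-keep b)
            (trans (cong inject₁ eq) (Fin.inject₁-lower₁ v N≢v))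

    rows′ : ∀ (b c : Box s) → toℕ (row b) ≡ toℕ (row c) → col b < col c →
            entry (insert r T) b Fin.< entry (insert r T) c
    rows′ b c p q with boxView r b | boxView r c
    ... | isCorner | isCorner = contradiction refl (ℕ.<⇒≢ q)
    ... | isCorner | isKept c′ rewrite col-keep r c′ | toℕ-row-keep r c′ =
            contradiction q (ℕ.<⇒≯ (corner-last-in-row r c′ (sym p)))
    ... | isKept b′ | isCorner = keep<corner b′
    ... | isKept b′ | isKept c′ = keep<keep b′ c′ (rows b′ c′
            (trans (sym (toℕ-row-keep r b′)) (trans p (toℕ-row-keep r c′)))
            (subst₂ _<_ (col-keep r b′) (col-keep r c′) q))

    cols′ : ∀ (b c : Box s) → col b ≡ col c → toℕ (row b) < toℕ (row c) →
            entry (insert r T) b Fin.< entry (insert r T) c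
    cols′ b c p q with boxView r b | boxView r c
    ... | isCorner | isCorner = contradiction refl (ℕ.<⇒≢ q)
    ... | isCorner | isKept c′ rewrite col-keep r c′ | toℕ-row-keep r c′ =
            contradiction q (ℕ.<⇒≯ (corner-last-in-column r c′ (sym p)))
    ... | isKept b′ | isCorner = keep<corner b′
    ... | isKept b′ | isKept c′ = keep<keep b′ c′ (cols b′ c′
            (trans (sym (col-keep r b′)) (trans p (col-keep r c′)))
            (subst₂ _<_ (toℕ-row-keep r b′) (toℕ-row-keep r c′) q))

  insert-standard⁻ : Standard (insert r T) → Standard T
  insert-standard⁻ (standard inj sur rows cols) = standard
    (λ b c eq → keep-injective r (inj _ _
      (trans (at-keep b) (trans (cong inject₁ eq) (sym (at-keep c))))))
    sur′
    (λ b c p q → keep<keep⁻ b c (rows _ _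
      (trans (toℕ-row-keep r b) (trans p (sym (toℕ-row-keep r c))))
      (subst₂ _<_ (sym (col-keep r b)) (sym (col-keep r c)) q)))
    (λ b c p q → keep<keep⁻ b c (cols _ _
      (trans (col-keep r b) (trans p (sym (col-keep r c))))
      (subst₂ _<_ (sym (toℕ-row-keep r b)) (sym (toℕ-row-keep r c)) q)))
    where
    sur′ : ∀ v → ∃ λ b → entry T b ≡ v
    sur′ v with sur (inject₁ v)
    ... | b , eq with boxView r b
    ... | isCorner = contradiction (trans (sym at-corner) eq) Fin.fromℕ≢inject₁
    ... | isKept b′ = b′ , Fin.inject₁-injective (trans (sym (at-keep b′)) eq)

map-inject₁-injective : ∀ {N n} (v w : Vec (Fin N) n) →
  Vec.map inject₁ v ≡ Vec.map inject₁ w → v ≡ w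
map-inject₁-injective []      []      _  = refl
map-inject₁-injective (x ∷ v) (y ∷ w) eq = cong₂ _∷_
  (Fin.inject₁-injective (Vec.∷-injectiveˡ eq))
  (map-inject₁-injective v w (Vec.∷-injectiveʳ eq))

∷-injective : ∀ {N y s} {v w : Vec (Fin N) y} {T U : FillingIn N s} →
  _≡_ {A = FillingIn N (y ∷ s)} (v ∷ T) (w ∷ U) → v ≡ w × T ≡ U
∷-injective refl = refl , refl

raise-injective : ∀ {N s} (T U : FillingIn N s) → raise T ≡ raise U → T ≡ U
raise-injective []      []      _  = refl
raise-injective (v ∷ T) (w ∷ U) eq with ∷-injective eq
... | p , q = cong₂ _∷_ (map-inject₁-injective v w p) (raise-injective T U q)

insert-injective : ∀ {N s t} (r : Removal s t) {T U : FillingIn N t} →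
  insert r T ≡ insert r U → T ≡ U
insert-injective (top _) {v ∷ T} {w ∷ U} eq with ∷-injective eq
... | p , q = cong₂ _∷_ (map-inject₁-injective v w (Vec.∷ʳ-injectiveˡ _ _ p))
                        (raise-injective T U q)
insert-injective (next r) {v ∷ T} {w ∷ U} eq with ∷-injective eq
... | p , q = cong₂ _∷_ (map-inject₁-injective v w p) (insert-injective r q)

inject₁⁻¹ : ∀ {N} (x : Fin (suc N)) → x ≢ fromℕ N → ∃ λ y → x ≡ inject₁ y
inject₁⁻¹ {N} x x≢ = Fin.lower₁ x N≢x , sym (Fin.inject₁-lower₁ x N≢x)
  where
  N≢x : N ≢ toℕ x
  N≢x eq = x≢ (Fin.toℕ-injective (sym (trans (Fin.toℕ-fromℕ N) eq)))

map-inject₁⁻¹ : ∀ {N n} (v : Vec (Fin (suc N)) n) →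
  (∀ j → Vec.lookup v j ≢ fromℕ N) → ∃ λ w → v ≡ Vec.map inject₁ w
map-inject₁⁻¹ []      _ = [] , refl
map-inject₁⁻¹ (x ∷ v) h with inject₁⁻¹ x (h Fin.zero) | map-inject₁⁻¹ v (h ∘ Fin.suc)
... | y , refl | w , refl = y ∷ w , refl

raise⁻¹ : ∀ {N s} (T : FillingIn (suc N) s) → (∀ b → entry T b ≢ fromℕ N) →
  ∃ λ U → T ≡ raise U
raise⁻¹ []      _ = [] , refl
raise⁻¹ (v ∷ T) h with map-inject₁⁻¹ v (h ∘ box Fin.zero) | raise⁻¹ T (h ∘ below)
... | w , refl | U , refl = w ∷ U , refl

insert⁻¹ : ∀ {N s t} (r : Removal s t) (T : FillingIn (suc N) s) →
  entry T (corner r) ≡ fromℕ N → (∀ b → entry T (keep r b) ≢ fromℕ N) →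
  ∃ λ U → T ≡ insert r U
insert⁻¹ (top _) (v ∷ T) p q with Vec.initLast v
... | v′ , x , refl with map-inject₁⁻¹ v′ (λ j eq → q (box Fin.zero j)
                           (trans (lookup-∷ʳ-inject₁ v′ x j) eq))
                       | raise⁻¹ T (q ∘ below)
                       | trans (sym (lookup-∷ʳ-last v′ x)) p
... | w , refl | U , refl | refl = w ∷ U , refl
insert⁻¹ (next r) (v ∷ T) p q with map-inject₁⁻¹ v (q ∘ box Fin.zero)
                                 | insert⁻¹ r T p (q ∘ below)
... | w , refl | U , refl = w ∷ U , refl

removal-at : ∀ {s} (b : Box s) →
  (∀ (c : Box s) → toℕ (row b) ≡ toℕ (row c) → ¬ col b < col c) →
  (∀ (c : Box s) → col b ≡ col c → ¬ toℕ (row b) < toℕ (row c)) →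
  ∃ λ t → ∃ λ (r : Removal s t) → corner r ≡ b
removal-at {suc y ∷ s} (box Fin.zero j) h k =
  _ , top (All.tabulate short) , cong (box Fin.zero)
    (Fin.toℕ-injective (trans (Fin.toℕ-fromℕ y) (sym j≡y)))
  where
  j≡y : toℕ j ≡ y
  j≡y with ℕ.m≤n⇒m<n∨m≡n (ℕ.s≤s⁻¹ (Fin.toℕ<n j))
  ... | inj₂ eq = eq
  ... | inj₁ lt = contradiction
          (subst (toℕ j <_) (sym (Fin.toℕ-fromℕ y)) lt) (h (box Fin.zero (fromℕ y)) refl)
  short : ∀ {x} → x ∈ s → x ≤ y
  short {x} x∈s with x ℕ.≤? y
  ... | yes x≤y = x≤y
  -- A row below of length more than `y` would have a box beneath the given one.
  ... | no x≰y = contradiction (s≤s z≤n) (k (box (Fin.suc (Any.index x∈s))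
          (Fin.fromℕ< (subst (y <_) (Any.lookup-index x∈s) (ℕ.≰⇒> x≰y))))
          (trans j≡y (sym (Fin.toℕ-fromℕ< _))))
removal-at {y ∷ s} (box (Fin.suc i) j) h k
  with removal-at (box {s} i j) (λ { c@(box _ _) p → h (below c) (cong suc p) })
                            (λ { c@(box _ _) p q → k (below c) p (s≤s q) })
... | t , r , eq = _ , next r , cong below eq

-- No entry exceeds the largest one, so its box has nothing to its right and nothing below: it is a
-- corner.
split-standard : ∀ {N s} (T : FillingIn (suc N) s) → Standard T →
  ∃ λ t → ∃ λ (r : Removal s t) → ∃ λ U → T ≡ insert r U × Standard U
split-standard {N} {s} T std@(standard inj sur rows cols) with sur (fromℕ N)
... | b , eq with removal-at b (λ c p q → not-above c (rows b c p q))
                               (λ c p q → not-above c (cols b c p q))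
  where
  not-above : ∀ c → ¬ entry T b Fin.< entry T c
  not-above c lt = ℕ.<⇒≱ (subst (Fin._< entry T c) eq lt) (Fin.≤fromℕ _)
... | t , r , refl with insert⁻¹ r T eq
                          (λ c e → keep≢corner r c (inj _ _ (trans e (sym eq))))
... | U , refl = t , r , U , refl , insert-standard⁻ r U std

-- Enumeration by removals

push : ∀ {y s} → ∃ (Removal s) → ∃ (Removal (y ∷ s))
push (_ , r) = _ , next r

removals : ∀ s → List (∃ (Removal s))
removals []          = []
removals (zero ∷ s)  = map push (removals s)
removals (suc y ∷ s) with All.all? (ℕ._≤? y) s
... | yes all≤ = (_ , top all≤) ∷ map push (removals s)
... | no _     = map push (removals s)

-- The constructor `top` carries a proof, so the list is only claimed to contain a removal with the
-- same corner; by `insert-cong` the corner is all that insertion depends on.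
removals-complete : ∀ {s t} (r : Removal s t) →
  ∃ λ r′ → (t , r′) ∈ removals s × corner r′ ≡ corner r
removals-complete (top {y} {s} all≤) with All.all? (ℕ._≤? y) s
... | yes all≤′ = _ , here refl , refl
... | no ¬all≤ = contradiction all≤ ¬all≤
removals-complete (next {zero} r) with removals-complete r
... | r′ , r∈ , eq = _ , ∈-map⁺ push r∈ , cong below eq
removals-complete (next {suc y} {s} r) with removals-complete r | All.all? (ℕ._≤? y) s
... | r′ , r∈ , eq | yes _ = _ , there (∈-map⁺ push r∈) , cong below eq
... | r′ , r∈ , eq | no _  = _ , ∈-map⁺ push r∈ , cong below eq

DistinctCorners : ∀ {s} → ∃ (Removal s) → ∃ (Removal s) → Set
DistinctCorners (_ , r) (_ , r′) = corner r ≢ corner r′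

below-injective : ∀ {y s} {b c : Box s} → below {y} b ≡ below c → b ≡ c
below-injective {b = box _ _} {box _ _} refl = refl

removals-distinct : ∀ s → AllPairs DistinctCorners (removals s)
removals-distinct-next : ∀ y s →
  AllPairs DistinctCorners (map (push {y}) (removals s))
removals-distinct []          = []
removals-distinct (zero ∷ s)  = removals-distinct-next zero s
removals-distinct (suc y ∷ s) with All.all? (ℕ._≤? y) s
... | yes _ = All.map⁺ (All.tabulate (λ _ ())) ∷ removals-distinct-next (suc y) s
... | no _  = removals-distinct-next (suc y) s
removals-distinct-next y s = AllPairs.map⁺
  (AllPairs.map (λ ≠ eq → ≠ (below-injective eq)) (removals-distinct s))

-- In the base case there is one filling if `s` has no boxes and none otherwise, so the list is
-- empty whenever `N` is not the size of `s` (`#Std-level`).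
enumerate : ∀ N s → List (FillingIn N s)
enumerate zero    s = fillings 0 s
enumerate (suc N) s = concatMap (λ (t , r) → map (insert r) (enumerate N t)) (removals s)

enumerate-unique : ∀ N s → Unique (enumerate N s)
enumerate-unique zero    s = fillings-unique 0 s
enumerate-unique (suc N) s = Unique.concat⁺
  (All.map⁺ (All.tabulate λ {(t , r)} _ → Unique.map⁺ (insert-injective r) (enumerate-unique N t)))
  (AllPairs.map⁺ (AllPairs.map disjoint (removals-distinct s)))
  where
  -- The largest entry of a filling reveals the corner at which it was inserted.
  disjoint : ∀ {p q : ∃ (Removal s)} → DistinctCorners p q →
    Disjoint (map (insert (proj₂ p)) (enumerate N _)) (map (insert (proj₂ q)) (enumerate N _))
  disjoint {_ , r} {_ , r′} ≠ (T∈ , T∈′) with ∈-map⁻ _ T∈ | ∈-map⁻ _ T∈′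
  ... | U , _ , refl | U′ , _ , eq = clash (boxView r′ (corner r)) refl
    where
    clash : ∀ {b} → BoxView r′ b → b ≢ corner r
    clash isCorner   e = ≠ (sym e)
    clash (isKept b) e = Fin.fromℕ≢inject₁ (begin
      fromℕ N                              ≡⟨ entry-insert-corner r U ⟨
      entry (insert r U) (corner r)        ≡⟨ cong₂ entry eq (sym e) ⟩
      entry (insert r′ U′) (keep r′ b)     ≡⟨ entry-insert-keep r′ U′ b ⟩
      inject₁ (entry U′ b)                 ∎)
      where open ≡-Reasoning

enumerate-sound : ∀ N {s} {T : FillingIn N s} → T ∈ enumerate N s → Standard T
enumerate-sound zero {s} {T} _ = standard
  (λ b → ⊥-elim (no-box b)) (λ ()) (λ b → ⊥-elim (no-box b)) (λ b → ⊥-elim (no-box b))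
  where
  no-box : Box s → ⊥
  no-box b with entry T b
  ... | ()
enumerate-sound (suc N) {s} T∈ with find (∈-concatMap⁻ _ {xs = removals s} T∈)
... | (t , r) , _ , T∈′ with ∈-map⁻ _ T∈′
... | U , U∈ , refl = insert-standard r U (enumerate-sound N U∈)

insert-cong : ∀ {N s t} (r r′ : Removal s t) → corner r ≡ corner r′ →
  (U : FillingIn N t) → insert r U ≡ insert r′ U
insert-cong (top _)  (top _)   _  (v ∷ U) = refl
insert-cong (next r) (next r′) eq (v ∷ U) =
  cong (_ ∷_) (insert-cong r r′ (below-injective eq) U)

enumerate-complete : ∀ N {s} {T : FillingIn N s} → Standard T → T ∈ enumerate N s
enumerate-complete zero    {T = T} _ = fillings-complete T
enumerate-complete (suc N) {T = T} std with split-standard T std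
... | t , r , U , refl , std′ with removals-complete r
... | r′ , r∈ , eq = ∈-concatMap⁺ _ (lose r∈ (subst (_∈ map (insert r′) (enumerate N t))
        (insert-cong r′ r eq U) (∈-map⁺ _ (enumerate-complete N std′))))

lookup-injective : ∀ {A : Set} {xs : List A} → Unique xs →
  ∀ i j → lookup xs i ≡ lookup xs j → i ≡ j
lookup-injective (x∉ ∷ u) Fin.zero    Fin.zero    _  = refl
lookup-injective (x∉ ∷ u) Fin.zero    (Fin.suc j) eq =
  contradiction eq (All.lookup x∉ (∈-lookup j))
lookup-injective (x∉ ∷ u) (Fin.suc i) Fin.zero    eq =
  contradiction (sym eq) (All.lookup x∉ (∈-lookup i))
lookup-injective (x∉ ∷ u) (Fin.suc i) (Fin.suc j) eq = cong Fin.suc (lookup-injective u i j eq)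

unique⇒length≤ : ∀ {A : Set} {xs ys : List A} → Unique xs →
  (∀ {x} → x ∈ xs → x ∈ ys) → length xs ≤ length ys
unique⇒length≤ {xs = xs} {ys} u ⊆ = Fin.injective⇒≤ {f = λ i → Any.index (⊆ (∈-lookup i))}
  λ {i} {j} eq → lookup-injective u i j (trans (Any.lookup-index (⊆ (∈-lookup i)))
    (trans (cong (lookup ys) eq) (sym (Any.lookup-index (⊆ (∈-lookup j))))))

-- This is what lets the recursive enumeration replace the filtered list of all fillings behind
-- `#SYT`.
enumeration-length : ∀ {A : Set} {P : A → Set} (E F : Enumeration P) →
  length (Enumeration.list E) ≡ length (Enumeration.list F)
enumeration-length E F = ℕ.≤-antisym
  (unique⇒length≤ (Enumeration.unique E) (Enumeration.complete F ∘ Enumeration.sound E))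
  (unique⇒length≤ (Enumeration.unique F) (Enumeration.complete E ∘ Enumeration.sound F))

standardFillings : ∀ s → Enumeration (IsSYT {s})
standardFillings s = record
  { list     = enumerate (sum s) s
  ; unique   = enumerate-unique (sum s) s
  ; sound    = toSYT ∘ enumerate-sound (sum s)
  ; complete = enumerate-complete (sum s) ∘ fromSYT
  }
  where
  toSYT : ∀ {T} → Standard T → IsSYT T
  toSYT (standard inj sur rows cols) = isSYT
    ((λ {b} {c} → inj b c) , λ v → proj₁ (sur v) , λ { refl → proj₂ (sur v) })
    (λ b c → rows b c ∘ cong toℕ) cols
  fromSYT : ∀ {T} → IsSYT T → Standard T
  fromSYT (isSYT (inj , sur) rows cols) = standard (λ b c → inj)
    (λ v → proj₁ (sur v) , proj₂ (sur v) refl) (λ b c → rows b c ∘ Fin.toℕ-injective) cols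

-- The branching rule

#Std : ℕ → Shape → ℤ
#Std N s = + length (enumerate N s)

#SYT≡#Std : ∀ s → + #SYT s ≡ #Std (sum s) s
#SYT≡#Std s = cong +_ (enumeration-length (SYTs s) (standardFillings s))

-- The down operator of Young's lattice, extended to arbitrary shapes. Recursion on the rows,
-- instead of a sum over `removals`, is what allows the comparison with `lower` one coordinate at a
-- time.
D : (Shape → ℤ) → Shape → ℤ
D φ []          = 0ℤ
D φ (zero ∷ s)  = D (φ ∘ (zero ∷_)) s
D φ (suc y ∷ s) = ⟦ All.all? (ℕ._≤? y) s ⟧ ℤ.* φ (y ∷ s) ℤ.+ D (φ ∘ (suc y ∷_)) s

D-removals : ∀ (φ : Shape → ℕ) s →
  D (λ t → + φ t) s ≡ + sum (map (φ ∘ proj₁) (removals s))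
D-removals-next : ∀ (φ : Shape → ℕ) y s → D (λ t → + φ (y ∷ t)) s
  ≡ + sum (map (φ ∘ proj₁) (map (push {y}) (removals s)))
D-removals-next φ y s =
  trans (D-removals (φ ∘ (y ∷_)) s) (cong (+_ ∘ sum) (List.map-∘ (removals s)))
D-removals φ []          = refl
D-removals φ (zero ∷ s)  = D-removals-next φ zero s
D-removals φ (suc y ∷ s) with All.all? (ℕ._≤? y) s
... | yes _ = cong₂ ℤ._+_ (ℤ.*-identityˡ (+ φ (y ∷ s))) (D-removals-next φ (suc y) s)
... | no _  = trans (ℤ.+-identityˡ _) (D-removals-next φ (suc y) s)

#Std-suc : ∀ N s → #Std (suc N) s ≡ D (#Std N) s
#Std-suc N s = trans (cong +_ (go (removals s))) (sym (D-removals (length ∘ enumerate N) s))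
  where
  go : ∀ rs → length (concatMap (λ (t , r) → map (insert r) (enumerate N t)) rs)
            ≡ sum (map (length ∘ enumerate N ∘ proj₁) rs)
  go []             = refl
  go ((t , r) ∷ rs) = trans (List.length-++ (map (insert r) (enumerate N t)))
    (cong₂ ℕ._+_ (List.length-map (insert r) (enumerate N t)) (go rs))

#Std-zero : ∀ s → sum s ≡ 0 → #Std 0 s ≡ 1ℤ
#Std-zero []         _  = refl
#Std-zero (zero ∷ s) eq = trans (cong +_ (trans (List.length-++ (map ([] ∷_) (fillings 0 s)))
  (trans (ℕ.+-identityʳ _) (List.length-map ([] ∷_) (fillings 0 s))))) (#Std-zero s eq)

D-level : ∀ φ N → (∀ t → sum t ≢ N → φ t ≡ 0ℤ) → ∀ s → sum s ≢ suc N → D φ s ≡ 0ℤ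
D-level φ N h []          _ = refl
D-level φ N h (zero ∷ s)  ≠ = D-level (φ ∘ (zero ∷_)) N (h ∘ (zero ∷_)) s ≠
D-level φ N h (suc y ∷ s) ≠ = cong₂ ℤ._+_
  (trans (cong (⟦ All.all? (ℕ._≤? y) s ⟧ ℤ.*_) (h (y ∷ s) (≠ ∘ cong suc))) (ℤ.*-zeroʳ ⟦ All.all? (ℕ._≤? y) s ⟧)) (go N h ≠)
  where
  go : ∀ N → (∀ t → sum t ≢ N → φ t ≡ 0ℤ) → sum (suc y ∷ s) ≢ suc N →
       D (φ ∘ (suc y ∷_)) s ≡ 0ℤ
  go N h ≠ with sum s ℕ.≟ suc (N ℕ.∸ suc y)
  ... | no p = D-level (φ ∘ (suc y ∷_)) (N ℕ.∸ suc y)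
          (λ t q → h (suc y ∷ t) λ e → q (sym (trans (cong (ℕ._∸ suc y) (sym e))
            (ℕ.m+n∸m≡n (suc y) (sum t))))) s p
  ... | yes p with suc y ℕ.≤? N
  ... | yes q = contradiction (trans (cong (suc y ℕ.+_) p)
          (trans (ℕ.+-suc (suc y) _) (cong suc (ℕ.m+[n∸m]≡n q)))) ≠
  -- Here `suc y` exceeds `N`, so `φ (suc y ∷ t)` is zero for every `t` and the level may be chosen
  -- freely; `sum s` is a choice that `s` does not sit just above.
  ... | no q = D-level (φ ∘ (suc y ∷_)) (sum s)
          (λ t _ → h (suc y ∷ t) λ e → q (subst (suc y ≤_) e (ℕ.m≤m+n (suc y) (sum t))))
          s (λ e → ℕ.1+n≢n (sym e))

#Std-level : ∀ N s → sum s ≢ N → #Std N s ≡ 0ℤ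
#Std-level zero    []          ≠ = contradiction refl ≠
#Std-level zero    (suc _ ∷ s) _ = refl
#Std-level zero    (zero ∷ s)  ≠ = trans (cong +_ (trans (List.length-++ (map ([] ∷_) (fillings 0 s)))
  (trans (ℕ.+-identityʳ _) (List.length-map ([] ∷_) (fillings 0 s))))) (#Std-level 0 s ≠)
#Std-level (suc N) s ≠ = trans (#Std-suc N s) (D-level (#Std N) N (#Std-level N) s ≠)

-- Vandermonde products

module _ where
  open import Data.Integer.Base using (_+_; _*_; _-_; -_)

  p : List ℤ → ℤ → ℤ
  p []       z = 1ℤ
  p (x ∷ xs) z = (z - x) * p xs z

  Δ : List ℤ → ℤ
  Δ []       = 1ℤ
  Δ (x ∷ xs) = p xs x * Δ xs

  sumℤ : List ℤ → ℤ
  sumℤ []       = 0ℤ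
  sumℤ (x ∷ xs) = x + sumℤ xs

  triangle : ℕ → ℕ
  triangle zero    = 0
  triangle (suc b) = b ℕ.+ triangle b

  -- Θ δ g xs sums g xᵢ (xs without xᵢ) (xs with xᵢ moved by δ) over all positions i.
  Θ : ℤ → (ℤ → List ℤ → List ℤ → ℤ) → List ℤ → ℤ
  Θ δ g []       = 0ℤ
  Θ δ g (w ∷ xs) = g w xs (δ + w ∷ xs) + Θ δ (λ y r s → g y (w ∷ r) (w ∷ s)) xs

  -- Records how the three arguments of a summand of `Θ` are related, so that `Θ-cong` need not
  -- prove summands equal at unrelated arguments.
  data Moved (δ : ℤ) : List ℤ → ℤ → List ℤ → List ℤ → Set where
    here  : ∀ {w xs} → Moved δ (w ∷ xs) w xs (δ + w ∷ xs)
    there : ∀ {w xs y r s} → Moved δ xs y r s → Moved δ (w ∷ xs) y (w ∷ r) (w ∷ s)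

  Θ-cong : ∀ {δ g h} xs → (∀ {y r s} → Moved δ xs y r s → g y r s ≡ h y r s) →
    Θ δ g xs ≡ Θ δ h xs
  Θ-cong []       eq = refl
  Θ-cong (w ∷ xs) eq = cong₂ _+_ (eq here) (Θ-cong xs (eq ∘ there))

  Θ-linear : ∀ δ c d g h xs →
    Θ δ (λ y r s → c * g y r s + d * h y r s) xs ≡ c * Θ δ g xs + d * Θ δ h xs
  Θ-linear δ c d g h []       = eq c d
    where
    eq : ∀ c d → 0ℤ ≡ c * 0ℤ + d * 0ℤ
    eq = solve-∀
  Θ-linear δ c d g h (w ∷ xs) = trans
    (cong₂ _+_ {x = c * g w xs (δ + w ∷ xs) + d * h w xs (δ + w ∷ xs)} refl
      (Θ-linear δ c d (λ y r s → g y (w ∷ r) (w ∷ s)) (λ y r s → h y (w ∷ r) (w ∷ s)) xs))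
    (eq c d (g w xs (δ + w ∷ xs)) (h w xs (δ + w ∷ xs)) (Θ δ _ xs) (Θ δ _ xs))
    where
    eq : ∀ c d a b x y → c * a + d * b + (c * x + d * y) ≡ c * (a + x) + d * (b + y)
    eq = solve-∀

  p-removed : ∀ {δ xs y r s} → Moved δ xs y r s → ∀ z → p xs z ≡ (z - y) * p r z
  p-removed here _ = refl
  p-removed (there {w} {y = y} {r} m) z = trans (cong ((z - w) *_) (p-removed m z)) (eq z w y (p r z))
    where
    eq : ∀ z w y a → (z - w) * ((z - y) * a) ≡ (z - y) * ((z - w) * a)
    eq = solve-∀

  p-moved : ∀ {δ xs y r s} → Moved δ xs y r s → ∀ z → p s z ≡ (z - y - δ) * p r z
  p-moved {δ} (here {w} {xs}) z = eq δ w z (p xs z)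
    where
    eq : ∀ δ w z a → (z - (δ + w)) * a ≡ (z - w - δ) * a
    eq = solve-∀
  p-moved {δ} (there {w} {y = y} {r} m) z = trans (cong ((z - w) *_) (p-moved m z)) (eq z w y δ (p r z))
    where
    eq : ∀ z w y δ a → (z - w) * ((z - y - δ) * a) ≡ (z - y - δ) * ((z - w) * a)
    eq = solve-∀

  -- Lagrange interpolation with denominators cleared. The polynomial `p xs z - p xs (δ + z)` has
  -- degree below the number of nodes, and at the node `xᵢ` its value is `-δ` times the product of
  -- the `xᵢ + δ - xⱼ`; moving `xᵢ` by `δ` multiplies `Δ` by the product of the
  -- `(xᵢ + δ - xⱼ) / (xᵢ - xⱼ)`. The induction on the list also covers repeated nodes.
  Θ-lagrange : ∀ δ z xs →
    - δ * Θ δ (λ y r s → p r z * Δ s) xs ≡ (p xs z - p xs (δ + z)) * Δ xs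
  Θ-lagrange δ z []       = eq δ
    where
    eq : ∀ δ → - δ * 0ℤ ≡ (1ℤ - 1ℤ) * 1ℤ
    eq = solve-∀
  Θ-lagrange δ z (w ∷ xs) = begin
    - δ * (pz * (qw * d) + Θ δ (λ y r s → ((z - w) * p r z) * (p s w * Δ s)) xs)
      ≡⟨ cong (λ t → - δ * (pz * (qw * d) + t)) (trans
           (Θ-cong xs λ {y} {r} {s} m → integrand m)
           (Θ-linear δ ((z - w) * pw + δ * pw) (- δ * pz) _ _ xs)) ⟩
    - δ * (pz * (qw * d) + (((z - w) * pw + δ * pw) * Vz + - δ * pz * Vw))
      ≡⟨ expand δ z w pz pw qw d Vz Vw ⟩
    - δ * pz * (qw * d) + (((z - w) * pw + δ * pw) * (- δ * Vz) + - δ * pz * (- δ * Vw))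
      ≡⟨ cong₂ (λ a b → - δ * pz * (qw * d) + (((z - w) * pw + δ * pw) * a + - δ * pz * b))
           (Θ-lagrange δ z xs) (Θ-lagrange δ w xs) ⟩
    - δ * pz * (qw * d) + (((z - w) * pw + δ * pw) * ((pz - qz) * d) + - δ * pz * ((pw - qw) * d))
      ≡⟨ collect δ z w pz pw qz qw d ⟩
    ((z - w) * pz - (δ + z - w) * qz) * (pw * d) ∎
    where
    open ≡-Reasoning
    pz = p xs z
    pw = p xs w
    qz = p xs (δ + z)
    qw = p xs (δ + w)
    d  = Δ xs
    Vz = Θ δ (λ y r s → p r z * Δ s) xs
    Vw = Θ δ (λ y r s → p r w * Δ s) xs
    -- (z - w) pᵢ(w) pᵢ(z) = p(z) pᵢ(w) - p(w) pᵢ(z), where pᵢ omits the factor of xᵢ.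
    integrand : ∀ {y r s} → Moved δ xs y r s →
      ((z - w) * p r z) * (p s w * Δ s)
      ≡ ((z - w) * pw + δ * pw) * (p r z * Δ s) + - δ * pz * (p r w * Δ s)
    integrand {y} {r} {s} m rewrite p-moved m w | p-removed m w | p-removed m z =
      eq δ z w y (p r z) (p r w) (Δ s)
      where
      eq : ∀ δ z w y a b c → ((z - w) * a) * (((w - y - δ) * b) * c)
        ≡ ((z - w) * ((w - y) * b) + δ * ((w - y) * b)) * (a * c) + - δ * ((z - y) * a) * (b * c)
      eq = solve-∀
    expand : ∀ δ z w pz pw qw d Vz Vw →
      - δ * (pz * (qw * d) + (((z - w) * pw + δ * pw) * Vz + - δ * pz * Vw))
      ≡ - δ * pz * (qw * d) + (((z - w) * pw + δ * pw) * (- δ * Vz) + - δ * pz * (- δ * Vw))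
    expand = solve-∀
    collect : ∀ δ z w pz pw qz qw d →
      - δ * pz * (qw * d) + (((z - w) * pw + δ * pw) * ((pz - qz) * d) + - δ * pz * ((pw - qw) * d))
      ≡ ((z - w) * pz - (δ + z - w) * qz) * (pw * d)
    collect = solve-∀

  -- When a later entry moves, the factor `p xs w` of the first entry `w` changes by `- δ * p r w`.
  -- By `Θ-lagrange` at `z = w` these changes cancel the term in which `w` itself moves, up to one
  -- copy of `Δ`.
  Θ-Δ : ∀ δ xs → Θ δ (λ y r s → Δ s) xs ≡ + length xs * Δ xs
  Θ-Δ δ []       = refl
  Θ-Δ δ (w ∷ xs) = begin
    qw * d + Θ δ (λ y r s → p s w * Δ s) xs
      ≡⟨ cong₂ _+_ {x = qw * d} refl (trans (Θ-cong xs λ {y} {r} {s} m → integrand m)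
                                 (Θ-linear δ pw (- δ) _ _ xs)) ⟩
    qw * d + (pw * Θ δ (λ y r s → Δ s) xs + - δ * Θ δ (λ y r s → p r w * Δ s) xs)
      ≡⟨ cong₂ (λ a b → qw * d + (pw * a + b)) (Θ-Δ δ xs) (Θ-lagrange δ w xs) ⟩
    qw * d + (pw * (+ length xs * d) + (pw - qw) * d)
      ≡⟨ collect pw qw d (+ length xs) ⟩
    (1ℤ + + length xs) * (pw * d) ∎
    where
    open ≡-Reasoning
    pw = p xs w
    qw = p xs (δ + w)
    d  = Δ xs
    integrand : ∀ {y r s} → Moved δ xs y r s →
      p s w * Δ s ≡ pw * Δ s + - δ * (p r w * Δ s)
    integrand {y} {r} {s} m rewrite p-moved m w | p-removed m w = eq δ w y (p r w) (Δ s)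
      where
      eq : ∀ δ w y b c → (w - y - δ) * b * c ≡ (w - y) * b * c + - δ * (b * c)
      eq = solve-∀
    collect : ∀ pw qw d n → qw * d + (pw * (n * d) + (pw - qw) * d) ≡ (1ℤ + n) * (pw * d)
    collect = solve-∀

  -- The identity behind both the hook length formula (`δ = -1`) and `lift-weight` (`δ = 1`). It
  -- reduces to `Θ-Δ` and `Θ-lagrange` by writing `y` as `w - (w - y)` in the terms where `y` meets
  -- the change of `p xs w`.
  Θ-yΔ : ∀ δ xs →
    Θ δ (λ y r s → y * Δ s) xs ≡ (sumℤ xs + δ * + triangle (length xs)) * Δ xs
  Θ-yΔ δ []       = eq δ
    where
    eq : ∀ δ → 0ℤ ≡ (0ℤ + δ * 0ℤ) * 1ℤ
    eq = solve-∀
  Θ-yΔ δ (w ∷ xs) = begin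
    w * (qw * d) + Θ δ (λ y r s → y * (p s w * Δ s)) xs
      ≡⟨ cong₂ _+_ {x = w * (qw * d)} refl (trans (Θ-cong xs λ {y} {r} {s} m → integrand m)
          (trans (Θ-linear δ 1ℤ (- δ * w) _ _ xs)
            (cong (λ t → 1ℤ * t + - δ * w * V) (Θ-linear δ pw (δ * pw) _ _ xs)))) ⟩
    w * (qw * d) + (1ℤ * (pw * M + δ * pw * Z) + - δ * w * V)
      ≡⟨ regroup (w * (qw * d)) (1ℤ * (pw * M + δ * pw * Z)) δ w V ⟩
    w * (qw * d) + (1ℤ * (pw * M + δ * pw * Z) + w * (- δ * V))
      ≡⟨ cong₂ (λ a b → w * (qw * d) + (1ℤ * (pw * a + δ * pw * b) + w * (- δ * V)))
           (Θ-yΔ δ xs) (Θ-Δ δ xs) ⟩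
    w * (qw * d) + (1ℤ * (pw * ((S + δ * T) * d) + δ * pw * (n * d)) + w * (- δ * V))
      ≡⟨ cong (λ a → w * (qw * d) + (1ℤ * (pw * ((S + δ * T) * d) + δ * pw * (n * d)) + w * a))
           (Θ-lagrange δ w xs) ⟩
    w * (qw * d) + (1ℤ * (pw * ((S + δ * T) * d) + δ * pw * (n * d)) + w * ((pw - qw) * d))
      ≡⟨ collect δ w pw qw d S T n ⟩
    (w + S + δ * (n + T)) * (pw * d) ∎
    where
    open ≡-Reasoning
    pw = p xs w
    qw = p xs (δ + w)
    d  = Δ xs
    S  = sumℤ xs
    T  = + triangle (length xs)
    n  = + length xs
    M  = Θ δ (λ y r s → y * Δ s) xs
    Z  = Θ δ (λ y r s → Δ s) xs
    V  = Θ δ (λ y r s → p r w * Δ s) xs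
    regroup : ∀ a b δ w V → a + (b + - δ * w * V) ≡ a + (b + w * (- δ * V))
    regroup = solve-∀
    integrand : ∀ {y r s} → Moved δ xs y r s →
      y * (p s w * Δ s) ≡ 1ℤ * (pw * (y * Δ s) + δ * pw * Δ s) + - δ * w * (p r w * Δ s)
    integrand {y} {r} {s} m rewrite p-moved m w | p-removed m w = eq δ w y (p r w) (Δ s)
      where
      eq : ∀ δ w y b c → y * ((w - y - δ) * b * c)
        ≡ 1ℤ * ((w - y) * b * (y * c) + δ * ((w - y) * b) * c) + - δ * w * (b * c)
      eq = solve-∀
    collect : ∀ δ w pw qw d S T n →
      w * (qw * d) + (1ℤ * (pw * ((S + δ * T) * d) + δ * pw * (n * d)) + w * ((pw - qw) * d))
      ≡ (w + S + δ * (n + T)) * (pw * d)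
    collect = solve-∀

-- Partitions as strictly decreasing sequences

Strict : List ℕ → Set
Strict = AllPairs _>_

strict? : ∀ l → Dec (Strict l)
strict? = AllPairs.allPairs? ℕ._>?_

-- Undoes the passage to coordinates. On a strict list the monus does not truncate, by
-- `length≤bound`.
shape : List ℕ → Shape
shape []      = []
shape (x ∷ l) = (x ℕ.∸ length l) ∷ shape l

data Up : List ℕ → List ℕ → Set where
  here  : ∀ {x l} → Up (x ∷ l) (suc x ∷ l)
  there : ∀ {x l m} → Up l m → Up (x ∷ l) (x ∷ m)

Up-length : ∀ {l m} → Up l m → length l ≡ length m
Up-length here      = refl
Up-length (there u) = cong suc (Up-length u)

Up-sum : ∀ {l m} → Up l m → sum m ≡ suc (sum l)
Up-sum here              = refl
Up-sum (there {x} {l} u) = trans (cong (x ℕ.+_) (Up-sum u)) (ℕ.+-suc x (sum l))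

Up-bounded : ∀ {x l m} → Up l m → All (x >_) m → All (x >_) l
Up-bounded here      (px ∷ ps) = ℕ.<-trans (ℕ.n<1+n _) px ∷ ps
Up-bounded (there u) (px ∷ ps) = px ∷ Up-bounded u ps

data Repeat : List ℕ → Set where
  here  : ∀ {x l} → x ∈ l → Repeat (x ∷ l)
  there : ∀ {x l} → Repeat l → Repeat (x ∷ l)

bounded⊎∈ : ∀ {y} l → All (suc y >_) l → All (y >_) l ⊎ y ∈ l
bounded⊎∈ []      []        = inj₁ []
bounded⊎∈ (x ∷ l) (px ∷ ps) with ℕ.m≤n⇒m<n∨m≡n (ℕ.s≤s⁻¹ px) | bounded⊎∈ l ps
... | inj₂ refl | _         = inj₂ (here refl)
... | inj₁ _    | inj₂ y∈   = inj₂ (there y∈)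
... | inj₁ x<y  | inj₁ all< = inj₁ (x<y ∷ all<)

Up-bounded⊎∈ : ∀ {x l m} → Up l m → All (x >_) l → All (x >_) m ⊎ x ∈ m
Up-bounded⊎∈ here (px ∷ ps) with ℕ.m≤n⇒m<n∨m≡n px
... | inj₁ lt   = inj₁ (lt ∷ ps)
... | inj₂ refl = inj₂ (here refl)
Up-bounded⊎∈ (there u) (px ∷ ps) with Up-bounded⊎∈ u ps
... | inj₁ qs = inj₁ (px ∷ qs)
... | inj₂ x∈ = inj₂ (there x∈)

-- A unit move can break strictness only by making two entries equal, and then `Δ` is zero by
-- `Δ-repeat`. Hence the indicator of strictness may be put in or left out wherever `Δ` is a factor.
Up-strict : ∀ {l m} → Up l m → Strict l → Strict m ⊎ Repeat m
Up-strict here      (ps ∷ st) = inj₁ (All.map ℕ.m<n⇒m<1+n ps ∷ st)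
Up-strict (there u) (ps ∷ st) with Up-strict u st | Up-bounded⊎∈ u ps
... | inj₂ rep | _       = inj₂ (there rep)
... | inj₁ _   | inj₂ x∈ = inj₂ (here x∈)
... | inj₁ st′ | inj₁ qs = inj₁ (qs ∷ st′)

Down-strict : ∀ {l m} → Up m l → Strict l → Strict m ⊎ Repeat m
Down-strict (here {x} {l}) (ps ∷ st) with bounded⊎∈ l ps
... | inj₁ qs = inj₁ (qs ∷ st)
... | inj₂ x∈ = inj₂ (here x∈)
Down-strict (there u) (ps ∷ st) with Down-strict u st
... | inj₁ st′ = inj₁ (Up-bounded u ps ∷ st′)
... | inj₂ rep = inj₂ (there rep)

length≤bound : ∀ {y} l → Strict l → All (y >_) l → length l ≤ y
length≤bound []      _         _         = z≤n
length≤bound (x ∷ l) (ps ∷ st) (x<y ∷ _) = ℕ.≤-trans (s≤s (length≤bound l st ps)) x<y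

sum-shape : ∀ l → Strict l → sum (shape l) ℕ.+ triangle (length l) ≡ sum l
sum-shape []      _         = refl
sum-shape (x ∷ l) (ps ∷ st) = begin
  x ℕ.∸ n ℕ.+ sum (shape l) ℕ.+ (n ℕ.+ triangle n)   ≡⟨ interchange (x ℕ.∸ n) (sum (shape l)) n (triangle n) ⟩
  x ℕ.∸ n ℕ.+ n ℕ.+ (sum (shape l) ℕ.+ triangle n)   ≡⟨ cong₂ ℕ._+_ (ℕ.m∸n+n≡m (length≤bound l st ps)) (sum-shape l st) ⟩
  x ℕ.+ sum l                                        ∎
  where
  open ≡-Reasoning
  n = length l
  interchange : ∀ a b c d → a ℕ.+ b ℕ.+ (c ℕ.+ d) ≡ a ℕ.+ c ℕ.+ (b ℕ.+ d)
  interchange = ℕ-Ring.solve-∀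

shape-bounded : ∀ {y} l → Strict l → All (y >_) l → All (_≤ y ℕ.∸ length l) (shape l)
shape-bounded []      _         _         = []
shape-bounded {y} (x ∷ l) (ps ∷ st) (x<y ∷ _) =
  x∸n≤ ∷ All.map (λ le → ℕ.≤-trans le x∸n≤) (shape-bounded l st ps)
  where
  x∸n≤ : x ℕ.∸ length l ≤ y ℕ.∸ suc (length l)
  x∸n≤ = ℕ.∸-monoˡ-≤ (suc (length l)) x<y

shape-bounded⁻ : ∀ {y} l → Strict l → length l ≤ y →
  All (_≤ y ℕ.∸ length l) (shape l) → All (y >_) l
shape-bounded⁻ []      _         _   _        = []
shape-bounded⁻ {y} (x ∷ l) (ps ∷ st) n<y (le ∷ _) =
  x<y ∷ All.map (λ lt → ℕ.<-trans lt x<y) ps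
  where
  open ℕ.≤-Reasoning
  n = length l
  x<y : x < y
  x<y = begin-strict
    x                              ≡⟨ ℕ.m∸n+n≡m (length≤bound l st ps) ⟨
    x ℕ.∸ n ℕ.+ n                  ≤⟨ ℕ.+-monoˡ-≤ n le ⟩
    y ℕ.∸ suc n ℕ.+ n              <⟨ ℕ.+-monoʳ-< (y ℕ.∸ suc n) (ℕ.n<1+n n) ⟩
    y ℕ.∸ suc n ℕ.+ suc n          ≡⟨ ℕ.m∸n+n≡m n<y ⟩
    y                              ∎

-- Lowering and raising one entry

lower : (List ℕ → ℤ) → List ℕ → ℤ
lower φ []          = 0ℤ
lower φ (zero ∷ l)  = lower (φ ∘ (zero ∷_)) l
lower φ (suc y ∷ l) = φ (y ∷ l) ℤ.+ lower (φ ∘ (suc y ∷_)) l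

lift : (List ℕ → ℤ) → List ℕ → ℤ
lift φ []      = 0ℤ
lift φ (x ∷ l) = φ (suc x ∷ l) ℤ.+ lift (φ ∘ (x ∷_)) l

lower-cong : ∀ {φ ψ} l → (∀ {m} → Up m l → φ m ≡ ψ m) → lower φ l ≡ lower ψ l
lower-cong []          eq = refl
lower-cong (zero ∷ l)  eq = lower-cong l (eq ∘ there)
lower-cong (suc y ∷ l) eq = cong₂ ℤ._+_ (eq here) (lower-cong l (eq ∘ there))

lift-cong : ∀ {φ ψ} l → (∀ {m} → Up l m → φ m ≡ ψ m) → lift φ l ≡ lift ψ l
lift-cong []      eq = refl
lift-cong (x ∷ l) eq = cong₂ ℤ._+_ (eq here) (lift-cong l (eq ∘ there))

-- The last box of a row is removable exactly if the list stays strict when the entry of that row is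
-- lowered.
D-shape : ∀ φ l → Strict l →
  D φ (shape l) ≡ lower (λ m → ⟦ strict? m ⟧ ℤ.* φ (shape m)) l
D-shape φ []      _         = refl
D-shape φ (x ∷ l) (ps ∷ st) = head x ps
  where
  tail : ∀ x → All (x >_) l → D (φ ∘ ((x ℕ.∸ length l) ∷_)) (shape l)
    ≡ lower (λ m → ⟦ strict? (x ∷ m) ⟧ ℤ.* φ (shape (x ∷ m))) l
  tail x ps = trans (D-shape _ l st) (lower-cong l λ {m} u → cong₂ ℤ._*_
    (⟦⟧-cong (strict? m) (strict? (x ∷ m)) (Up-bounded u ps ∷_) AllPairs.tail)
    (cong (λ n → φ ((x ℕ.∸ n) ∷ shape m)) (sym (Up-length u))))
  head : ∀ x → All (x >_) l → D φ ((x ℕ.∸ length l) ∷ shape l)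
    ≡ lower (λ m → ⟦ strict? m ⟧ ℤ.* φ (shape m)) (x ∷ l)
  head zero ps = trans (cong (λ z → D φ (z ∷ shape l)) (ℕ.0∸n≡0 (length l)))
    (trans (cong (λ z → D (φ ∘ (z ∷_)) (shape l)) (sym (ℕ.0∸n≡0 (length l)))) (tail zero ps))
  head (suc y) ps with length l ℕ.≤? y
  ... | yes n≤y rewrite ℕ.+-∸-assoc 1 n≤y = cong₂ ℤ._+_
    (cong (ℤ._* φ ((y ℕ.∸ length l) ∷ shape l)) (⟦⟧-cong (All.all? _ (shape l)) (strict? (y ∷ l))
      (λ le → shape-bounded⁻ l st n≤y le ∷ st) (λ { (qs ∷ _) → shape-bounded l st qs })))
    (trans (cong (λ z → D (φ ∘ (z ∷_)) (shape l)) (sym (ℕ.+-∸-assoc 1 n≤y))) (tail (suc y) ps))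
  -- The row is empty, so `D` has no term for it; on the other side the lowered entry is smaller
  -- than the number of entries after it, which excludes strictness.
  ... | no n≰y = trans (cong (λ z → D φ (z ∷ shape l)) full)
    (trans (cong (λ z → D (φ ∘ (z ∷_)) (shape l)) (sym full))
    (trans (tail (suc y) ps)
    (sym (trans (cong₂ ℤ._+_ (cong (ℤ._* φ (shape (y ∷ l)))
      (⟦⟧-no (strict? (y ∷ l)) λ { (qs ∷ _) → n≰y (length≤bound l st qs) })) refl)
      (ℤ.+-identityˡ _)))))
    where
    full : suc y ℕ.∸ length l ≡ 0
    full = ℕ.m≤n⇒m∸n≡0 (ℕ.≰⇒> n≰y)

-- The hook length formula in coordinates

ι : List ℕ → List ℤ
ι = map +_

module _ where
  open import Data.Integer.Base using (_+_; _*_; _-_; -_)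

  F : List ℕ → ℤ
  F []      = 1ℤ
  F (x ∷ l) = + (x !) * F l

  lower-* : ∀ φ c l → lower (λ m → φ m * c) l ≡ lower φ l * c
  lower-* φ c []          = refl
  lower-* φ c (zero ∷ l)  = lower-* (φ ∘ (zero ∷_)) c l
  lower-* φ c (suc y ∷ l) = trans (cong₂ _+_ {x = φ (y ∷ l) * c} refl (lower-* (φ ∘ (suc y ∷_)) c l))
    (sym (ℤ.*-distribʳ-+ c (φ (y ∷ l)) _))

  -- Lowering an entry `y` divides `F` by `y`, which accounts for the factor `y` under `Θ`. At an
  -- entry 0 this factor is zero, matching the move that `lower` leaves out.
  lower-F : ∀ φ (K : List ℤ → ℤ) l → (∀ {m} → Up m l → φ m * F m ≡ K (ι m)) →
    lower φ l * F l ≡ Θ -1ℤ (λ y r s → y * K s) (ι l)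
  lower-F-tail : ∀ φ (K : List ℤ → ℤ) x l → (∀ {m} → Up m (x ∷ l) → φ m * F m ≡ K (ι m)) →
    lower (φ ∘ (x ∷_)) l * F (x ∷ l) ≡ Θ -1ℤ (λ y r s → y * K (+ x ∷ s)) (ι l)

  lower-F φ K []          eq = refl
  lower-F φ K (zero ∷ l)  eq = trans (lower-F-tail φ K zero l eq) (sym (ℤ.+-identityˡ _))
  lower-F φ K (suc y ∷ l) eq = begin
    (φ (y ∷ l) + rest) * (+ (suc y !) * F l)
      ≡⟨ cong (λ c → (φ (y ∷ l) + rest) * (c * F l)) (ℤ.pos-* (suc y) (y !)) ⟩
    (φ (y ∷ l) + rest) * (+ suc y * + (y !) * F l)
      ≡⟨ distribute (φ (y ∷ l)) rest (+ suc y) (+ (y !)) (F l) ⟩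
    + suc y * (φ (y ∷ l) * (+ (y !) * F l)) + rest * (+ suc y * + (y !) * F l)
      ≡⟨ cong₂ _+_ (cong (λ t → + suc y * t) (eq here))
           (cong (λ c → rest * (c * F l)) (sym (ℤ.pos-* (suc y) (y !)))) ⟩
    + suc y * K (+ y ∷ ι l) + rest * F (suc y ∷ l)
      ≡⟨ cong₂ _+_ {x = + suc y * K (+ y ∷ ι l)} refl (lower-F-tail φ K (suc y) l eq) ⟩
    + suc y * K (+ y ∷ ι l) + Θ -1ℤ (λ z r s → z * K (+ suc y ∷ s)) (ι l) ∎
    where
    open ≡-Reasoning
    rest = lower (φ ∘ (suc y ∷_)) l
    distribute : ∀ a b c d e → (a + b) * (c * d * e) ≡ c * (a * (d * e)) + b * (c * d * e)
    distribute = solve-∀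

  lower-F-tail φ K x l eq = begin
    lower (φ ∘ (x ∷_)) l * (+ (x !) * F l)
      ≡⟨ ℤ.*-assoc (lower (φ ∘ (x ∷_)) l) (+ (x !)) (F l) ⟨
    lower (φ ∘ (x ∷_)) l * + (x !) * F l
      ≡⟨ cong (_* F l) (sym (lower-* (φ ∘ (x ∷_)) (+ (x !)) l)) ⟩
    lower (λ m → φ (x ∷ m) * + (x !)) l * F l
      ≡⟨ lower-F (λ m → φ (x ∷ m) * + (x !)) (λ s → K (+ x ∷ s)) l
           (λ {m} u → trans (ℤ.*-assoc (φ (x ∷ m)) (+ (x !)) (F m)) (eq (there u))) ⟩
    Θ -1ℤ (λ y r s → y * K (+ x ∷ s)) (ι l) ∎
    where open ≡-Reasoning

  p-∈ : ∀ {x l} → x ∈ l → p (ι l) (+ x) ≡ 0ℤ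
  p-∈ {x} {y ∷ l} (here refl) = cong (_* p (ι l) (+ x)) (ℤ.+-inverseʳ (+ x))
  p-∈ {x} {y ∷ l} (there x∈)  = trans (cong (λ t → (+ x - + y) * t) (p-∈ x∈)) (ℤ.*-zeroʳ (+ x - + y))

  Δ-repeat : ∀ {l} → Repeat l → Δ (ι l) ≡ 0ℤ
  Δ-repeat {x ∷ l} (here x∈)   = cong (_* Δ (ι l)) (p-∈ x∈)
  Δ-repeat {x ∷ l} (there rep) = trans (cong (λ t → p (ι l) (+ x) * t) (Δ-repeat rep)) (ℤ.*-zeroʳ (p (ι l) (+ x)))

  -- The coordinates of the rectangle with `b` rows of length `a` (`shape-desc`).
  desc : ℕ → ℕ → List ℕ
  desc zero    a = []
  desc (suc b) a = b ℕ.+ a ∷ desc b a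

  -- The superfactorial `0! 1! ⋯ (n - 1)!`.
  sf : ℕ → ℤ
  sf zero    = 1ℤ
  sf (suc n) = + (n !) * sf n

  pos-difference : ∀ i a → + (i ℕ.+ a) - + a ≡ + i
  pos-difference i a = trans (cong (_- + a) (ℤ.pos-+ i a)) (eq (+ i) (+ a))
    where
    eq : ∀ x y → x + y - y ≡ x
    eq = solve-∀

  -- The factors are `i + 1, …, i + k`. The offset `i` serves the induction: taking off the largest
  -- root raises it by one.
  p-desc : ∀ k i a → p (ι (desc k a)) (+ (i ℕ.+ k ℕ.+ a)) * + (i !) ≡ + ((i ℕ.+ k) !)
  p-desc zero    i a = trans (ℤ.*-identityˡ (+ (i !))) (cong (λ n → + (n !)) (sym (ℕ.+-identityʳ i)))
  p-desc (suc k) i a = begin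
    (+ (i ℕ.+ suc k ℕ.+ a) - + (k ℕ.+ a)) * p (ι (desc k a)) (+ (i ℕ.+ suc k ℕ.+ a)) * + (i !)
      ≡⟨ cong (λ n → (+ (n ℕ.+ a) - + (k ℕ.+ a)) * p (ι (desc k a)) (+ (n ℕ.+ a)) * + (i !)) (ℕ.+-suc i k) ⟩
    (+ (suc i ℕ.+ k ℕ.+ a) - + (k ℕ.+ a)) * P * + (i !)
      ≡⟨ cong (λ t → t * P * + (i !))
           (trans (cong (λ n → + n - + (k ℕ.+ a)) (ℕ.+-assoc (suc i) k a)) (pos-difference (suc i) (k ℕ.+ a))) ⟩
    + suc i * P * + (i !)
      ≡⟨ rearrange (+ suc i) P (+ (i !)) ⟩
    P * (+ suc i * + (i !))
      ≡⟨ cong (λ t → P * t) (sym (ℤ.pos-* (suc i) (i !))) ⟩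
    P * + (suc i !)
      ≡⟨ p-desc k (suc i) a ⟩
    + ((suc i ℕ.+ k) !)
      ≡⟨ cong (λ n → + (n !)) (sym (ℕ.+-suc i k)) ⟩
    + ((i ℕ.+ suc k) !) ∎
    where
    open ≡-Reasoning
    P = p (ι (desc k a)) (+ (suc i ℕ.+ k ℕ.+ a))
    rearrange : ∀ x y z → x * y * z ≡ y * (x * z)
    rearrange = solve-∀

  p-++ : ∀ xs ys z → p (xs ++ ys) z ≡ p xs z * p ys z
  p-++ []       ys z = sym (ℤ.*-identityˡ (p ys z))
  p-++ (x ∷ xs) ys z = trans (cong (λ t → (z - x) * t) (p-++ xs ys z)) (sym (ℤ.*-assoc (z - x) (p xs z) (p ys z)))

  -- The part of the Vandermonde product of `desc k a ++ l` that mixes the two pieces.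
  R : ℕ → ℕ → List ℕ → ℤ
  R zero    a l = 1ℤ
  R (suc k) a l = p (ι l) (+ (k ℕ.+ a)) * R k a l

  Δ-desc-++ : ∀ k a l → Δ (ι (desc k a ++ l)) ≡ sf k * R k a l * Δ (ι l)
  Δ-desc-++ zero    a l = sym (trans (cong (_* Δ (ι l)) (ℤ.*-identityˡ 1ℤ)) (ℤ.*-identityˡ (Δ (ι l))))
  Δ-desc-++ (suc k) a l = begin
    p (ι (desc k a ++ l)) z * Δ (ι (desc k a ++ l))
      ≡⟨ cong₂ _*_ (trans (cong (λ xs → p xs z) (List.map-++ (λ n → + n) (desc k a) l)) (p-++ (ι (desc k a)) (ι l) z))
                   (Δ-desc-++ k a l) ⟩
    p (ι (desc k a)) z * p (ι l) z * (sf k * R k a l * Δ (ι l))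
      ≡⟨ cong (λ t → t * p (ι l) z * (sf k * R k a l * Δ (ι l)))
           (trans (sym (ℤ.*-identityʳ (p (ι (desc k a)) z))) (p-desc k 0 a)) ⟩
    + (k !) * p (ι l) z * (sf k * R k a l * Δ (ι l))
      ≡⟨ rearrange (+ (k !)) (p (ι l) z) (sf k) (R k a l) (Δ (ι l)) ⟩
    + (k !) * sf k * (p (ι l) z * R k a l) * Δ (ι l) ∎
    where
    open ≡-Reasoning
    z = + (k ℕ.+ a)
    rearrange : ∀ a b c d e → a * b * (c * d * e) ≡ a * c * (b * d) * e
    rearrange = solve-∀

  R-[] : ∀ k a → R k a [] ≡ 1ℤ
  R-[] zero    a = refl
  R-[] (suc k) a = trans (ℤ.*-identityˡ (R k a [])) (R-[] k a)

  Δ-desc : ∀ k a → Δ (ι (desc k a)) ≡ sf k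
  Δ-desc k a = trans (cong (Δ ∘ ι) (sym (List.++-identityʳ (desc k a)))) (trans (Δ-desc-++ k a [])
    (trans (cong (λ t → sf k * t * 1ℤ) (R-[] k a))
      (trans (ℤ.*-identityʳ (sf k * 1ℤ)) (ℤ.*-identityʳ (sf k)))))

  F-desc : ∀ k a → F (desc k a) * sf a ≡ sf (k ℕ.+ a)
  F-desc zero    a = ℤ.*-identityˡ (sf a)
  F-desc (suc k) a = trans (ℤ.*-assoc (+ ((k ℕ.+ a) !)) (F (desc k a)) (sf a))
    (cong (λ t → + ((k ℕ.+ a) !) * t) (F-desc k a))

  F-++ : ∀ l m → F (l ++ m) ≡ F l * F m
  F-++ []      m = sym (ℤ.*-identityˡ (F m))
  F-++ (x ∷ l) m = trans (cong (λ t → + (x !) * t) (F-++ l m)) (sym (ℤ.*-assoc (+ (x !)) (F l) (F m)))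

  shape-empty : ∀ l → Strict l → sum (shape l) ≡ 0 → l ≡ desc (length l) 0
  shape-empty []      _         _  = refl
  shape-empty (x ∷ l) (ps ∷ st) eq = cong₂ _∷_
    (trans (ℕ.≤-antisym (ℕ.m∸n≡0⇒m≤n (ℕ.m+n≡0⇒m≡0 (x ℕ.∸ length l) eq)) (length≤bound l st ps))
           (sym (ℕ.+-identityʳ (length l))))
    (shape-empty l st (ℕ.m+n≡0⇒n≡0 (x ℕ.∸ length l) eq))

  sumℤ-ι : ∀ l → sumℤ (ι l) ≡ + sum l
  sumℤ-ι []      = refl
  sumℤ-ι (x ∷ l) = trans (cong (λ t → + x + t) (sumℤ-ι l)) (sym (ℤ.pos-+ x (sum l)))

  Up-sum-shape : ∀ {l m} → Up l m → Strict l → Strict m → sum (shape m) ≡ suc (sum (shape l))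
  Up-sum-shape {l} {m} u sl sm = ℕ.+-cancelʳ-≡ (triangle (length m)) _ _
    (trans (sum-shape m sm) (trans (Up-sum u) (cong suc
      (trans (sym (sum-shape l sl)) (cong (λ n → sum (shape l) ℕ.+ triangle n) (Up-length u))))))

  -- The Frobenius-Young form of the hook length formula.
  hook : ∀ N l → Strict l → sum (shape l) ≡ N → #Std N (shape l) * F l ≡ + (N !) * Δ (ι l)
  hook zero l st eq = begin
    #Std 0 (shape l) * F l     ≡⟨ cong₂ (λ a m → a * F m) (#Std-zero (shape l) eq) l≡ ⟩
    1ℤ * F (desc n 0)          ≡⟨ cong (λ t → 1ℤ * t) (trans (sym (ℤ.*-identityʳ _)) (trans (F-desc n 0) (cong sf (ℕ.+-identityʳ n)))) ⟩
    1ℤ * sf n                  ≡⟨ cong (λ t → 1ℤ * t) (sym (Δ-desc n 0)) ⟩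
    1ℤ * Δ (ι (desc n 0))      ≡⟨ cong (λ m → 1ℤ * Δ (ι m)) l≡ ⟨
    1ℤ * Δ (ι l)               ∎
    where
    open ≡-Reasoning
    n = length l
    l≡ : l ≡ desc n 0
    l≡ = shape-empty l st eq
  hook (suc N) l st eq = begin
    #Std (suc N) (shape l) * F l
      ≡⟨ cong (_* F l) (trans (#Std-suc N (shape l)) (D-shape (#Std N) l st)) ⟩
    lower (λ m → ⟦ strict? m ⟧ * #Std N (shape m)) l * F l
      ≡⟨ lower-F _ (λ s → + (N !) * Δ s) l below-hook ⟩
    Θ -1ℤ (λ y r s → y * (+ (N !) * Δ s)) (ι l)
      ≡⟨ trans (Θ-cong (ι l) λ {y} {r} {s} _ → shuffle y (+ (N !)) (Δ s))
           (Θ-linear -1ℤ (+ (N !)) 0ℤ (λ y r s → y * Δ s) (λ y r s → 0ℤ) (ι l)) ⟩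
    + (N !) * Θ -1ℤ (λ y r s → y * Δ s) (ι l) + 0ℤ * Θ -1ℤ (λ y r s → 0ℤ) (ι l)
      ≡⟨ ℤ.+-identityʳ _ ⟩
    + (N !) * Θ -1ℤ (λ y r s → y * Δ s) (ι l)
      ≡⟨ cong (λ t → + (N !) * t) (trans (Θ-yΔ -1ℤ (ι l)) (cong (_* Δ (ι l)) size)) ⟩
    + (N !) * (+ suc N * Δ (ι l))
      ≡⟨ swap (+ (N !)) (+ suc N) (Δ (ι l)) ⟩
    + suc N * + (N !) * Δ (ι l)
      ≡⟨ cong (_* Δ (ι l)) (sym (ℤ.pos-* (suc N) (N !))) ⟩
    + (suc N !) * Δ (ι l) ∎
    where
    open ≡-Reasoning
    -- If `m` is not strict, then it has a repeated entry and both sides are zero.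
    below-hook : ∀ {m} → Up m l → ⟦ strict? m ⟧ * #Std N (shape m) * F m ≡ + (N !) * Δ (ι m)
    below-hook {m} u with strict? m
    ... | yes sm = trans (cong (_* F m) (ℤ.*-identityˡ (#Std N (shape m))))
            (hook N m sm (ℕ.suc-injective (trans (sym (Up-sum-shape u sm st)) eq)))
    ... | no ¬sm with Down-strict u st
    ... | inj₁ sm  = contradiction sm ¬sm
    ... | inj₂ rep = sym (trans (cong (λ t → + (N !) * t) (Δ-repeat rep)) (ℤ.*-zeroʳ (+ (N !))))
    -- At `δ = -1` the coefficient in `Θ-yΔ` is the number of boxes, and this raises `N !` to
    -- `suc N !`.
    size : sumℤ (ι l) + -1ℤ * + triangle (length (ι l)) ≡ + suc N
    size = begin
      sumℤ (ι l) + -1ℤ * + triangle (length (ι l))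
        ≡⟨ cong₂ (λ a n → a + -1ℤ * + triangle n) (trans (sumℤ-ι l) (cong (λ n → + n) (sym (sum-shape l st)))) (List.length-map (λ n → + n) l) ⟩
      + (sum (shape l) ℕ.+ t) + -1ℤ * + t
        ≡⟨ cong₂ (λ a b → a + b) (trans (cong (λ n → + (n ℕ.+ t)) eq) (ℤ.pos-+ (suc N) t)) (refl {x = -1ℤ * + t}) ⟩
      + suc N + + t + -1ℤ * + t
        ≡⟨ cancel (+ suc N) (+ t) ⟩
      + suc N ∎
      where
      t = triangle (length l)
      cancel : ∀ a b → a + b + -1ℤ * b ≡ a
      cancel = solve-∀
    shuffle : ∀ y c d → y * (c * d) ≡ c * (y * d) + 0ℤ * 0ℤ
    shuffle = solve-∀
    swap : ∀ a b c → a * (b * c) ≡ b * a * c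
    swap = solve-∀

-- Sums over lists, adjointness, and the weight of a rectangle

module _ where
  open import Data.Integer.Base using (_+_; _*_; _-_; -_)
  open ≡-Reasoning

  ∑ : ℕ → (ℕ → ℤ) → ℤ
  ∑ zero    f = 0ℤ
  ∑ (suc n) f = ∑ n f + f n

  ∑-cong : ∀ n {f g : ℕ → ℤ} → (∀ x → x < n → f x ≡ g x) → ∑ n f ≡ ∑ n g
  ∑-cong zero    eq = refl
  ∑-cong (suc n) eq = cong₂ _+_ (∑-cong n (λ x lt → eq x (ℕ.m<n⇒m<1+n lt))) (eq n (ℕ.n<1+n n))

  ∑-+ : ∀ n (f g : ℕ → ℤ) → ∑ n (λ x → f x + g x) ≡ ∑ n f + ∑ n g
  ∑-+ zero    f g = refl
  ∑-+ (suc n) f g = trans (cong (_+ (f n + g n)) (∑-+ n f g)) (eq (∑ n f) (∑ n g) (f n) (g n))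
    where
    eq : ∀ a b c d → a + b + (c + d) ≡ a + c + (b + d)
    eq = solve-∀

  ∑-* : ∀ n c (f : ℕ → ℤ) → ∑ n (λ x → c * f x) ≡ c * ∑ n f
  ∑-* zero    c f = sym (ℤ.*-zeroʳ c)
  ∑-* (suc n) c f = trans (cong (_+ c * f n) (∑-* n c f)) (sym (ℤ.*-distribˡ-+ c (∑ n f) (f n)))

  ∑-shift : ∀ n (f : ℕ → ℤ) → ∑ (suc n) f ≡ f 0 + ∑ n (f ∘ suc)
  ∑-shift zero    f = trans (ℤ.+-identityˡ (f 0)) (sym (ℤ.+-identityʳ (f 0)))
  ∑-shift (suc n) f = trans (cong (_+ f (suc n)) (∑-shift n f)) (ℤ.+-assoc (f 0) (∑ n (f ∘ suc)) (f (suc n)))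

  ∑-zero : ∀ n {f : ℕ → ℤ} → (∀ x → x < n → f x ≡ 0ℤ) → ∑ n f ≡ 0ℤ
  ∑-zero zero    eq = refl
  ∑-zero (suc n) eq = cong₂ _+_ (∑-zero n (λ x lt → eq x (ℕ.m<n⇒m<1+n lt))) (eq n (ℕ.n<1+n n))

  ∑-single : ∀ n {f : ℕ → ℤ} {x} → x < n → (∀ y → y ≢ x → f y ≡ 0ℤ) → ∑ n f ≡ f x
  ∑-single (suc n) {f} {x} x<1+n eq with ℕ.m≤n⇒m<n∨m≡n (ℕ.s≤s⁻¹ x<1+n)
  ... | inj₁ x<n  = trans (cong₂ _+_ (∑-single n x<n eq) (eq n (ℕ.<⇒≢ x<n ∘ sym))) (ℤ.+-identityʳ (f x))
  ... | inj₂ refl = trans (cong (_+ f n) (∑-zero n (λ y y<n → eq y (ℕ.<⇒≢ y<n)))) (ℤ.+-identityˡ (f n))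

  -- The range is a full cube, not the strict lists, so that a single coordinate can be shifted
  -- independently of the others; strictness enters as an indicator.
  ∑ᵇ : ℕ → ℕ → (List ℕ → ℤ) → ℤ
  ∑ᵇ M zero    φ = φ []
  ∑ᵇ M (suc b) φ = ∑ M (λ x → ∑ᵇ M b (φ ∘ (x ∷_)))

  ∑ᵇ-cong : ∀ M b {φ ψ} → (∀ l → length l ≡ b → φ l ≡ ψ l) → ∑ᵇ M b φ ≡ ∑ᵇ M b ψ
  ∑ᵇ-cong M zero    eq = eq [] refl
  ∑ᵇ-cong M (suc b) eq = ∑-cong M (λ x _ → ∑ᵇ-cong M b (λ l e → eq (x ∷ l) (cong suc e)))

  ∑ᵇ-+ : ∀ M b φ ψ → ∑ᵇ M b (λ l → φ l + ψ l) ≡ ∑ᵇ M b φ + ∑ᵇ M b ψ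
  ∑ᵇ-+ M zero    φ ψ = refl
  ∑ᵇ-+ M (suc b) φ ψ = trans (∑-cong M (λ x _ → ∑ᵇ-+ M b (φ ∘ (x ∷_)) (ψ ∘ (x ∷_)))) (∑-+ M _ _)

  ∑ᵇ-* : ∀ M b c φ → ∑ᵇ M b (λ l → c * φ l) ≡ c * ∑ᵇ M b φ
  ∑ᵇ-* M zero    c φ = refl
  ∑ᵇ-* M (suc b) c φ = trans (∑-cong M (λ x _ → ∑ᵇ-* M b c (φ ∘ (x ∷_)))) (∑-* M c _)

  ∑ᵇ-zero : ∀ M b {φ} → (∀ l → length l ≡ b → φ l ≡ 0ℤ) → ∑ᵇ M b φ ≡ 0ℤ
  ∑ᵇ-zero M zero    eq = eq [] refl
  ∑ᵇ-zero M (suc b) eq = ∑-zero M (λ x _ → ∑ᵇ-zero M b (λ l e → eq (x ∷ l) (cong suc e)))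

  ∑ᵇ-single : ∀ M b {φ} l → length l ≡ b → All (M >_) l →
    (∀ m → length m ≡ b → m ≢ l → φ m ≡ 0ℤ) → ∑ᵇ M b φ ≡ φ l
  ∑ᵇ-single M zero    []      refl []       eq = refl
  ∑ᵇ-single M (suc b) (x ∷ l) refl (px ∷ ps) eq = trans
    (∑-single M px (λ y y≢x → ∑ᵇ-zero M b
      (λ m e → eq (y ∷ m) (cong suc e) (y≢x ∘ List.∷-injectiveˡ))))
    (∑ᵇ-single M b l refl ps (λ m e m≢l → eq (x ∷ m) (cong suc e) (m≢l ∘ List.∷-injectiveʳ)))

  -- Summation by parts in each coordinate, by the substitution of `suc x` for `x`. The boundary
  -- term at `M` vanishes by hypothesis, and the one at 0 because `lower` has no term there.
  lift-lower-adjoint : ∀ M b u v → (∀ l → length l ≡ b → Any (_≡ M) l → u l ≡ 0ℤ) →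
    ∑ᵇ M b (λ l → u l * lower v l) ≡ ∑ᵇ M b (λ l → lift u l * v l)
  lift-lower-adjoint M zero    u v u-zero = ℤ.*-zeroʳ (u [])
  lift-lower-adjoint M (suc b) u v u-zero = begin
    ∑ M (λ x → ∑ᵇ M b (λ l → u (x ∷ l) * lower v (x ∷ l)))
      ≡⟨ ∑-cong M (λ x _ → trans (∑ᵇ-cong M b (λ l _ → split x l)) (∑ᵇ-+ M b _ _)) ⟩
    ∑ M (λ x → f x + ∑ᵇ M b (λ l → u (x ∷ l) * lower (v ∘ (x ∷_)) l))
      ≡⟨ ∑-+ M f _ ⟩
    ∑ M f + ∑ M (λ x → ∑ᵇ M b (λ l → u (x ∷ l) * lower (v ∘ (x ∷_)) l))
      ≡⟨ cong₂ _+_ shifted (∑-cong M (λ x _ → lift-lower-adjoint M b (u ∘ (x ∷_)) (v ∘ (x ∷_))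
           (λ l e any → u-zero (x ∷ l) (cong suc e) (there any)))) ⟩
    ∑ M (λ x → ∑ᵇ M b (λ l → u (suc x ∷ l) * v (x ∷ l)))
      + ∑ M (λ x → ∑ᵇ M b (λ l → lift (u ∘ (x ∷_)) l * v (x ∷ l)))
      ≡⟨ sym (∑-+ M _ _) ⟩
    ∑ M (λ x → ∑ᵇ M b (λ l → u (suc x ∷ l) * v (x ∷ l)) + ∑ᵇ M b (λ l → lift (u ∘ (x ∷_)) l * v (x ∷ l)))
      ≡⟨ ∑-cong M (λ x _ → trans (sym (∑ᵇ-+ M b _ _)) (∑ᵇ-cong M b (λ l _ →
           sym (ℤ.*-distribʳ-+ (v (x ∷ l)) (u (suc x ∷ l)) (lift (u ∘ (x ∷_)) l))))) ⟩
    ∑ M (λ x → ∑ᵇ M b (λ l → (u (suc x ∷ l) + lift (u ∘ (x ∷_)) l) * v (x ∷ l))) ∎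
    where
    h : ℕ → List ℕ → ℤ
    h zero    l = 0ℤ
    h (suc y) l = v (y ∷ l)
    f : ℕ → ℤ
    f x = ∑ᵇ M b (λ l → u (x ∷ l) * h x l)
    split : ∀ x l → u (x ∷ l) * lower v (x ∷ l) ≡ u (x ∷ l) * h x l + u (x ∷ l) * lower (v ∘ (x ∷_)) l
    split zero    l = trans (sym (ℤ.+-identityˡ (u (zero ∷ l) * lower (v ∘ (zero ∷_)) l)))
      (cong (_+ u (zero ∷ l) * lower (v ∘ (zero ∷_)) l) (sym (ℤ.*-zeroʳ (u (zero ∷ l)))))
    split (suc y) l = ℤ.*-distribˡ-+ (u (suc y ∷ l)) (v (y ∷ l)) _
    shifted : ∑ M f ≡ ∑ M (λ x → ∑ᵇ M b (λ l → u (suc x ∷ l) * v (x ∷ l)))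
    shifted = begin
      ∑ M f                  ≡⟨ ℤ.+-identityʳ (∑ M f) ⟨
      ∑ M f + 0ℤ             ≡⟨ cong₂ _+_ {x = ∑ M f} refl (sym (∑ᵇ-zero M b (λ l e →
                                  cong (_* h M l) (u-zero (M ∷ l) (cong suc e) (here refl))))) ⟩
      ∑ (suc M) f            ≡⟨ ∑-shift M f ⟩
      f 0 + ∑ M (f ∘ suc)    ≡⟨ cong (_+ ∑ M (f ∘ suc)) (∑ᵇ-zero M b (λ l _ → ℤ.*-zeroʳ (u (zero ∷ l)))) ⟩
      0ℤ + ∑ M (f ∘ suc)     ≡⟨ ℤ.+-identityˡ (∑ M (f ∘ suc)) ⟩
      ∑ M (f ∘ suc)          ∎

  -- For `l < C` this is `(C - 1)! / (C - 1 - l)!`. The numbers `C - 1 - lᵢ` are the coordinates of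
  -- the complement of the shape in a rectangle, so `Δ (ι l) * G C l` is, up to a constant, the hook
  -- length formula of the complement without the factorial of its size. For positive `C` it
  -- vanishes as soon as an entry reaches `C`, that is, outside the rectangle.
  fall : ℕ → ℕ → ℤ
  fall C zero    = 1ℤ
  fall C (suc l) = fall C l * (+ C - 1ℤ - + l)

  G : ℕ → List ℕ → ℤ
  G C []      = 1ℤ
  G C (x ∷ l) = fall C x * G C l

  fall-zero : ∀ {C l} → C ≤ l → C > 0 → fall C l ≡ 0ℤ
  fall-zero {C} {suc l} C≤1+l C>0 with ℕ.m≤n⇒m<n∨m≡n C≤1+l
  ... | inj₁ C<1+l = cong (_* (+ C - 1ℤ - + l)) (fall-zero (ℕ.s≤s⁻¹ C<1+l) C>0)
  ... | inj₂ refl  = trans (cong (λ t → fall C l * t) (eq (+ l))) (ℤ.*-zeroʳ (fall C l))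
    where
    eq : ∀ x → 1ℤ + x - 1ℤ - x ≡ 0ℤ
    eq = solve-∀
  fall-zero {zero} {zero} _ ()

  weight : ℕ → List ℕ → ℤ
  weight C l = Δ (ι l) * G C l

  lift-G : ∀ C (K : List ℤ → ℤ) l → lift (λ m → K (ι m) * G C m) l
    ≡ Θ 1ℤ (λ y r s → (+ C - 1ℤ - y) * K s) (ι l) * G C l
  lift-G C K []      = refl
  lift-G C K (x ∷ l) = begin
    K (+ suc x ∷ ι l) * (fall C x * c * G C l) + lift (λ m → K (+ x ∷ ι m) * (fall C x * G C m)) l
      ≡⟨ cong₂ _+_ {x = K (+ suc x ∷ ι l) * (fall C x * c * G C l)} refl
           (trans (lift-cong l (λ {m} _ → sym (ℤ.*-assoc (K (+ x ∷ ι m)) (fall C x) (G C m))))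
                  (lift-G C (λ s → K (+ x ∷ s) * fall C x) l)) ⟩
    K (+ suc x ∷ ι l) * (fall C x * c * G C l) + Θ 1ℤ (λ y r s → (+ C - 1ℤ - y) * (K (+ x ∷ s) * fall C x)) (ι l) * G C l
      ≡⟨ cong (λ t → K (+ suc x ∷ ι l) * (fall C x * c * G C l) + t * G C l)
           (trans (Θ-cong (ι l) λ {y} {r} {s} _ → pull (+ C - 1ℤ - y) (K (+ x ∷ s)) (fall C x))
                  (Θ-linear 1ℤ (fall C x) 0ℤ (λ y r s → (+ C - 1ℤ - y) * K (+ x ∷ s)) (λ y r s → 0ℤ) (ι l))) ⟩
    K (+ suc x ∷ ι l) * (fall C x * c * G C l) + (fall C x * Q + 0ℤ * Θ 1ℤ (λ y r s → 0ℤ) (ι l)) * G C l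
      ≡⟨ collect (K (+ suc x ∷ ι l)) (fall C x) c (G C l) Q (Θ 1ℤ (λ y r s → 0ℤ) (ι l)) ⟩
    (c * K (+ suc x ∷ ι l) + Q) * (fall C x * G C l) ∎
    where
    c = + C - 1ℤ - + x
    Q = Θ 1ℤ (λ y r s → (+ C - 1ℤ - y) * K (+ x ∷ s)) (ι l)
    pull : ∀ a b d → a * (b * d) ≡ d * (a * b) + 0ℤ * 0ℤ
    pull = solve-∀
    collect : ∀ k f c g q z → k * (f * c * g) + (f * q + 0ℤ * z) * g ≡ (c * k + q) * (f * g)
    collect = solve-∀

  -- Raising an entry `x` multiplies `G` by `C - 1 - x`, so `Θ-Δ` and `Θ-yΔ` evaluate the sum. The
  -- coefficient depends on `l` only through its length and its sum: `weight` is an eigenvector on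
  -- each level.
  lift-weight : ∀ C l → lift (weight C) l
    ≡ ((+ C - 1ℤ) * + length l - + sum l - + triangle (length l)) * weight C l
  lift-weight C l = begin
    lift (weight C) l
      ≡⟨ lift-G C Δ l ⟩
    Θ 1ℤ (λ y r s → (+ C - 1ℤ - y) * Δ s) (ι l) * G C l
      ≡⟨ cong (_* G C l) (trans (Θ-cong (ι l) λ {y} {r} {s} _ → distribute (+ C - 1ℤ) y (Δ s))
           (Θ-linear 1ℤ (+ C - 1ℤ) -1ℤ (λ y r s → Δ s) (λ y r s → y * Δ s) (ι l))) ⟩
    ((+ C - 1ℤ) * Θ 1ℤ (λ y r s → Δ s) (ι l) + -1ℤ * Θ 1ℤ (λ y r s → y * Δ s) (ι l)) * G C l
      ≡⟨ cong₂ (λ a b → ((+ C - 1ℤ) * a + -1ℤ * b) * G C l) (Θ-Δ 1ℤ (ι l)) (Θ-yΔ 1ℤ (ι l)) ⟩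
    ((+ C - 1ℤ) * (+ length (ι l) * Δ (ι l)) + -1ℤ * ((sumℤ (ι l) + 1ℤ * + triangle (length (ι l))) * Δ (ι l))) * G C l
      ≡⟨ cong₂ (λ n t → ((+ C - 1ℤ) * (+ n * Δ (ι l)) + -1ℤ * ((t + 1ℤ * + triangle n) * Δ (ι l))) * G C l)
           (List.length-map (λ n → + n) l) (sumℤ-ι l) ⟩
    ((+ C - 1ℤ) * (+ length l * Δ (ι l)) + -1ℤ * ((+ sum l + 1ℤ * + triangle (length l)) * Δ (ι l))) * G C l
      ≡⟨ collect (+ C - 1ℤ) (+ length l) (Δ (ι l)) (+ sum l) (+ triangle (length l)) (G C l) ⟩
    ((+ C - 1ℤ) * + length l - + sum l - + triangle (length l)) * (Δ (ι l) * G C l) ∎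
    where
    distribute : ∀ c y d → (c - y) * d ≡ c * d + -1ℤ * (y * d)
    distribute = solve-∀
    collect : ∀ c n d s t g → (c * (n * d) + -1ℤ * ((s + 1ℤ * t) * d)) * g ≡ (c * n - s - t) * (d * g)
    collect = solve-∀

  G-zero : ∀ {C l} → C > 0 → Any (C ≤_) l → G C l ≡ 0ℤ
  G-zero {C} {x ∷ l} C>0 (here C≤x)  = cong (_* G C l) (fall-zero C≤x C>0)
  G-zero {C} {x ∷ l} C>0 (there any) = trans (cong (λ t → fall C x * t) (G-zero C>0 any)) (ℤ.*-zeroʳ (fall C x))

  weight-zero : ∀ a l → Any (length l ℕ.+ a ≤_) l → weight (length l ℕ.+ a) l ≡ 0ℤ
  weight-zero a l@(_ ∷ _) any = trans (cong (λ t → Δ (ι l) * t) (G-zero (s≤s z≤n) any)) (ℤ.*-zeroʳ (Δ (ι l)))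

  -- The bound `M` of the summation is separate from the `C` of the weight, so that sums for two
  -- different rectangles can be compared term by term over one range.
  pairing : ℕ → ℕ → ℕ → (List ℕ → ℤ) → ℤ
  pairing C M b φ = ∑ᵇ M b (λ l → ⟦ strict? l ⟧ * weight C l * φ l)

  pairing-cong : ∀ C M b {φ ψ} → (∀ l → length l ≡ b → Strict l → φ l ≡ ψ l) →
    pairing C M b φ ≡ pairing C M b ψ
  pairing-cong C M b {φ} {ψ} eq = ∑ᵇ-cong M b go
    where
    go : ∀ l → length l ≡ b → ⟦ strict? l ⟧ * weight C l * φ l ≡ ⟦ strict? l ⟧ * weight C l * ψ l
    go l e with strict? l
    ... | yes st = cong (λ t → 1ℤ * weight C l * t) (eq l e st)
    ... | no _   = refl

  pairing-+ : ∀ C M b φ ψ → pairing C M b (λ l → φ l + ψ l) ≡ pairing C M b φ + pairing C M b ψ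
  pairing-+ C M b φ ψ = trans
    (∑ᵇ-cong M b (λ l _ → ℤ.*-distribˡ-+ (⟦ strict? l ⟧ * weight C l) (φ l) (ψ l))) (∑ᵇ-+ M b _ _)

  twice-triangle : ∀ b → + triangle b + + triangle b ≡ + b * + b - + b
  twice-triangle zero    = refl
  twice-triangle (suc b) = begin
    + (b ℕ.+ triangle b) + + (b ℕ.+ triangle b)
      ≡⟨ cong (λ t → t + t) (ℤ.pos-+ b (triangle b)) ⟩
    + b + + triangle b + (+ b + + triangle b)
      ≡⟨ regroup (+ b) (+ triangle b) ⟩
    + triangle b + + triangle b + (+ b + + b)
      ≡⟨ cong (_+ (+ b + + b)) (twice-triangle b) ⟩
    + b * + b - + b + (+ b + + b)
      ≡⟨ square (+ b) ⟩
    (1ℤ + + b) * (1ℤ + + b) - (1ℤ + + b) ∎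
    where
    regroup : ∀ a t → a + t + (a + t) ≡ t + t + (a + a)
    regroup = solve-∀
    square : ∀ a → a * a - a + (a + a) ≡ (1ℤ + a) * (1ℤ + a) - (1ℤ + a)
    square = solve-∀

  -- The eigenvalue is the size of the rectangle minus the size of the shape.
  level-coefficient : ∀ a l → Strict l →
    (+ (length l ℕ.+ a) - 1ℤ) * + length l - + sum l - + triangle (length l)
    ≡ + a * + length l - + sum (shape l)
  level-coefficient a l st = begin
    (+ (n ℕ.+ a) - 1ℤ) * + n - + sum l - + triangle n
      ≡⟨ cong₂ (λ c s → (c - 1ℤ) * + n - s - + triangle n) (ℤ.pos-+ n a)
           (trans (cong (λ m → + m) (sym (sum-shape l st))) (ℤ.pos-+ (sum (shape l)) (triangle n))) ⟩
    (+ n + + a - 1ℤ) * + n - (+ sum (shape l) + + triangle n) - + triangle n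
      ≡⟨ regroup (+ n) (+ a) (+ sum (shape l)) (+ triangle n) ⟩
    (+ n + + a - 1ℤ) * + n - + sum (shape l) - (+ triangle n + + triangle n)
      ≡⟨ cong (λ t → (+ n + + a - 1ℤ) * + n - + sum (shape l) - t) (twice-triangle n) ⟩
    (+ n + + a - 1ℤ) * + n - + sum (shape l) - (+ n * + n - + n)
      ≡⟨ collect (+ n) (+ a) (+ sum (shape l)) ⟩
    + a * + n - + sum (shape l) ∎
    where
    n = length l
    regroup : ∀ n a s t → (n + a - 1ℤ) * n - (s + t) - t ≡ (n + a - 1ℤ) * n - s - (t + t)
    regroup = solve-∀
    collect : ∀ n a s → (n + a - 1ℤ) * n - s - (n * n - n) ≡ a * n - s
    collect = solve-∀

  -- In coordinates `D` is `lower`; adjointness moves it onto the weight, where it acts as a scalar,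
  -- the same one throughout because `Φ` lives on a single level.
  pairing-D : ∀ a M b s (Φ : Shape → ℤ) → b ℕ.+ a ≤ M → (∀ t → sum t ≢ s → Φ t ≡ 0ℤ) →
    pairing (b ℕ.+ a) M b (λ l → D Φ (shape l))
    ≡ (+ a * + b - + s) * pairing (b ℕ.+ a) M b (Φ ∘ shape)
  pairing-D a M b s Φ C≤M level = begin
    pairing C M b (λ l → D Φ (shape l))
      ≡⟨ pairing-cong C M b (λ l _ st → D-shape Φ l st) ⟩
    ∑ᵇ M b (λ l → ⟦ strict? l ⟧ * weight C l * lower (λ m → ⟦ strict? m ⟧ * Φ (shape m)) l)
      ≡⟨ lift-lower-adjoint M b _ _ (λ { l refl any → trans (cong (λ t → ⟦ strict? l ⟧ * t)
           (weight-zero a l (Any.map (λ { refl → C≤M }) any))) (ℤ.*-zeroʳ ⟦ strict? l ⟧) }) ⟩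
    ∑ᵇ M b (λ l → lift (λ m → ⟦ strict? m ⟧ * weight C m) l * (⟦ strict? l ⟧ * Φ (shape l)))
      ≡⟨ ∑ᵇ-cong M b pointwise ⟩
    ∑ᵇ M b (λ l → (+ a * + b - + s) * (⟦ strict? l ⟧ * weight C l * Φ (shape l)))
      ≡⟨ ∑ᵇ-* M b (+ a * + b - + s) (λ l → ⟦ strict? l ⟧ * weight C l * Φ (shape l)) ⟩
    (+ a * + b - + s) * pairing C M b (Φ ∘ shape) ∎
    where
    C = b ℕ.+ a
    unrestricted : ∀ l → Strict l → lift (λ m → ⟦ strict? m ⟧ * weight C m) l ≡ lift (weight C) l
    unrestricted l st = lift-cong l go
      where
      go : ∀ {m} → Up l m → ⟦ strict? m ⟧ * weight C m ≡ weight C m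
      go {m} u with strict? m
      ... | yes _ = ℤ.*-identityˡ (weight C m)
      ... | no ¬st with Up-strict u st
      ... | inj₁ st′ = contradiction st′ ¬st
      ... | inj₂ rep = sym (cong (_* G C m) (Δ-repeat rep))
    rearrange : ∀ a b c → a * b * (1ℤ * c) ≡ a * (1ℤ * b * c)
    rearrange = solve-∀
    pointwise : ∀ l → length l ≡ b →
      lift (λ m → ⟦ strict? m ⟧ * weight C m) l * (⟦ strict? l ⟧ * Φ (shape l))
      ≡ (+ a * + b - + s) * (⟦ strict? l ⟧ * weight C l * Φ (shape l))
    pointwise l refl with strict? l
    ... | no _   = trans (ℤ.*-zeroʳ (lift (λ m → ⟦ strict? m ⟧ * weight C m) l))
                         (sym (ℤ.*-zeroʳ (+ a * + b - + s)))
    ... | yes st with sum (shape l) ℕ.≟ s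
    ... | no ≢s rewrite level (shape l) ≢s | ℤ.*-zeroʳ (1ℤ * weight C l)
      = trans (ℤ.*-zeroʳ (lift (λ m → ⟦ strict? m ⟧ * weight C m) l)) (sym (ℤ.*-zeroʳ (+ a * + b - + s)))
    ... | yes refl = begin
      lift (λ m → ⟦ strict? m ⟧ * weight C m) l * (1ℤ * Φ (shape l))
        ≡⟨ cong (_* (1ℤ * Φ (shape l))) (trans (unrestricted l st) (lift-weight C l)) ⟩
      ((+ C - 1ℤ) * + b - + sum l - + triangle b) * weight C l * (1ℤ * Φ (shape l))
        ≡⟨ cong (λ t → t * weight C l * (1ℤ * Φ (shape l))) (level-coefficient a l st) ⟩
      (+ a * + b - + s) * weight C l * (1ℤ * Φ (shape l))
        ≡⟨ rearrange (+ a * + b - + s) (weight C l) (Φ (shape l)) ⟩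
      (+ a * + b - + s) * (1ℤ * weight C l * Φ (shape l)) ∎

  length-desc : ∀ b a → length (desc b a) ≡ b
  length-desc zero    a = refl
  length-desc (suc b) a = cong suc (length-desc b a)

  desc-bounded : ∀ b a → All (b ℕ.+ a >_) (desc b a)
  desc-bounded zero    a = []
  desc-bounded (suc b) a = ℕ.≤-refl ∷ All.map ℕ.m<n⇒m<1+n (desc-bounded b a)

  desc-strict : ∀ b a → Strict (desc b a)
  desc-strict zero    a = []
  desc-strict (suc b) a = desc-bounded b a ∷ desc-strict b a

  shape-desc : ∀ b a → shape (desc b a) ≡ replicate b a
  shape-desc zero    a = refl
  shape-desc (suc b) a = cong₂ _∷_
    (trans (cong (b ℕ.+ a ℕ.∸_) (length-desc b a)) (ℕ.m+n∸m≡n b a)) (shape-desc b a)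

  sum-bounded : ∀ {a} s → All (_≤ a) s → sum s ≤ length s ℕ.* a
  sum-bounded []      []       = z≤n
  sum-bounded (x ∷ s) (p ∷ ps) = ℕ.+-mono-≤ p (sum-bounded s ps)

  length-shape : ∀ l → length (shape l) ≡ length l
  length-shape []      = refl
  length-shape (x ∷ l) = cong suc (length-shape l)

  full⇒desc : ∀ {a} l → Strict l → All (_≤ a) (shape l) → sum (shape l) ≡ length l ℕ.* a →
    l ≡ desc (length l) a
  full⇒desc     []      _         _        _  = refl
  full⇒desc {a} (x ∷ l) (ps ∷ st) (q ∷ qs) eq = cong₂ _∷_
    (trans (sym (ℕ.m+[n∸m]≡n (length≤bound l st ps))) (cong (length l ℕ.+_) x∸n≡a))
    (full⇒desc l st qs (ℕ.+-cancelˡ-≡ a _ _ (trans (cong (ℕ._+ sum (shape l)) (sym x∸n≡a)) eq)))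
    where
    rest≤ : sum (shape l) ≤ length l ℕ.* a
    rest≤ = subst (λ n → sum (shape l) ≤ n ℕ.* a) (length-shape l) (sum-bounded (shape l) qs)
    x∸n≡a : x ℕ.∸ length l ≡ a
    x∸n≡a = ℕ.≤-antisym q (ℕ.+-cancelʳ-≤ (length l ℕ.* a) a (x ℕ.∸ length l)
      (subst (_≤ x ℕ.∸ length l ℕ.+ length l ℕ.* a) eq (ℕ.+-monoʳ-≤ (x ℕ.∸ length l) rest≤)))

  -- The weight removes every list with an entry of at least `b + a`, so only shapes with rows of
  -- length at most `a` remain, and full size leaves nothing but the rectangle.
  pairing-top : ∀ a M b φ → b ℕ.+ a ≤ M →
    (∀ l → length l ≡ b → Strict l → sum (shape l) ≢ b ℕ.* a → φ l ≡ 0ℤ) →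
    pairing (b ℕ.+ a) M b φ ≡ weight (b ℕ.+ a) (desc b a) * φ (desc b a)
  pairing-top a M b φ C≤M level = trans
    (∑ᵇ-single M b (desc b a) (length-desc b a) (All.map (λ lt → ℕ.≤-trans lt C≤M) (desc-bounded b a)) vanish)
    (cong (_* φ (desc b a)) (trans (cong (_* weight C (desc b a)) (⟦⟧-yes (strict? (desc b a)) (desc-strict b a)))
      (ℤ.*-identityˡ (weight C (desc b a)))))
    where
    C = b ℕ.+ a
    vanish : ∀ l → length l ≡ b → l ≢ desc b a → ⟦ strict? l ⟧ * weight C l * φ l ≡ 0ℤ
    vanish l refl l≢ with strict? l
    ... | no _   = refl
    ... | yes st with All.all? (ℕ._<? C) l
    ... | no ¬all = cong (_* φ l) (trans (ℤ.*-identityˡ (weight C l))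
            (weight-zero a l (Any.map ℕ.≮⇒≥ (All.¬All⇒Any¬ (ℕ._<? C) l ¬all))))
    ... | yes all with sum (shape l) ℕ.≟ b ℕ.* a
    ... | no ≢full  = trans (cong (λ t → 1ℤ * weight C l * t) (level l refl st ≢full)) (ℤ.*-zeroʳ (1ℤ * weight C l))
    ... | yes full = contradiction (full⇒desc l st
            (All.map (λ {x} → subst (x ≤_) (ℕ.m+n∸m≡n b a)) (shape-bounded l st all)) full) l≢

-- Shapes with a rectangle on top

sum-replicate-++ : ∀ k a s → sum (replicate k a ++ s) ≡ k ℕ.* a ℕ.+ sum s
sum-replicate-++ zero    a s = refl
sum-replicate-++ (suc k) a s = trans (cong (a ℕ.+_) (sum-replicate-++ k a s)) (sym (ℕ.+-assoc a (k ℕ.* a) (sum s)))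

sum-replicate : ∀ k a → sum (replicate k a) ≡ k ℕ.* a
sum-replicate k a = trans (cong sum (sym (List.++-identityʳ (replicate k a))))
  (trans (sum-replicate-++ k a []) (ℕ.+-identityʳ (k ℕ.* a)))

-- A coordinate counts the rows beneath it, hence the shift of the upper block by `length l`.
shape-desc-++ : ∀ k a l → shape (desc k (length l ℕ.+ a) ++ l) ≡ replicate k a ++ shape l
shape-desc-++ zero    a l = refl
shape-desc-++ (suc k) a l = cong₂ _∷_ (trans
  (cong₂ ℕ._∸_ (sym (ℕ.+-assoc k (length l) a)) (trans (List.length-++ (desc k (length l ℕ.+ a)))
    (cong (ℕ._+ length l) (length-desc k (length l ℕ.+ a)))))
  (ℕ.m+n∸m≡n (k ℕ.+ length l) a)) (shape-desc-++ k a l)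

desc-++-strict : ∀ k a l → Strict l → All (a >_) l → Strict (desc k a ++ l)
desc-++-strict zero    a l st all = st
desc-++-strict (suc k) a l st all =
  All.++⁺ (desc-bounded k a) (All.map (λ lt → ℕ.<-≤-trans lt (ℕ.m≤n+m a k)) all)
  ∷ desc-++-strict k a l st all

-- While the box at the end of the row of length suc a is present, the rows of
-- length a above it are not removable.
D-truncated : ∀ φ k a s → D φ (replicate k a ++ suc a ∷ s)
  ≡ ⟦ All.all? (ℕ._≤? a) s ⟧ ℤ.* φ (replicate (suc k) a ++ s)
    ℤ.+ D (λ t → φ (replicate k a ++ suc a ∷ t)) s
D-truncated φ zero    a       s = refl
D-truncated φ (suc k) zero    s = D-truncated (φ ∘ (zero ∷_)) k zero s
D-truncated φ (suc k) (suc a) s = trans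
  (cong₂ ℤ._+_ (cong (ℤ._* φ (a ∷ replicate k (suc a) ++ suc (suc a) ∷ s)) (⟦⟧-no
    (All.all? (ℕ._≤? a) (replicate k (suc a) ++ suc (suc a) ∷ s))
    (λ all → ℕ.<⇒≱ (ℕ.m<n⇒m<1+n (ℕ.n<1+n a)) (All.head (All.++⁻ʳ (replicate k (suc a)) all)))))
    (D-truncated (φ ∘ (suc a ∷_)) k (suc a) s))
  (ℤ.+-identityˡ _)

-- Recurrences for the weighted sums

module _ where
  open import Data.Integer.Base using (_+_; _*_; _-_; -_; _^_)
  open ≡-Reasoning

  !-nonZero : ∀ n → ℤ.NonZero (+ (n !))
  !-nonZero n = n ℕ.!≢0

  F-nonZero : ∀ l → ℤ.NonZero (F l)
  F-nonZero []      = _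
  F-nonZero (x ∷ l) = ℤ.i*j≢0 (+ (x !)) (F l) {{ !-nonZero x }} {{F-nonZero l}}

  sf-nonZero : ∀ n → ℤ.NonZero (sf n)
  sf-nonZero zero    = _
  sf-nonZero (suc n) = ℤ.i*j≢0 (+ (n !)) (sf n) {{ !-nonZero n }} {{sf-nonZero n}}

  fall-nonZero : ∀ C l → l < C → ℤ.NonZero (fall C l)
  fall-nonZero C zero    _     = _
  fall-nonZero C (suc l) 1+l<C = ℤ.i*j≢0 (fall C l) (+ C - 1ℤ - + l)
    {{fall-nonZero C l (ℕ.<-trans (ℕ.n<1+n l) 1+l<C)}} {{ℤ.≢-nonZero factor≢0}}
    where
    restore : ∀ c l → c - 1ℤ - l + (1ℤ + l) ≡ c
    restore = solve-∀
    factor≢0 : + C - 1ℤ - + l ≢ 0ℤ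
    factor≢0 eq = ℕ.<⇒≢ 1+l<C (ℤ.+-injective
      (trans (trans (sym (ℤ.+-identityˡ (1ℤ + + l))) (cong (_+ (1ℤ + + l)) (sym eq))) (restore (+ C) (+ l))))

  G-nonZero : ∀ C l → All (C >_) l → ℤ.NonZero (G C l)
  G-nonZero C []      []       = _
  G-nonZero C (x ∷ l) (p ∷ ps) = ℤ.i*j≢0 (fall C x) (G C l) {{fall-nonZero C x p}} {{G-nonZero C l ps}}

  weight-desc-nonZero : ∀ b a → ℤ.NonZero (weight (b ℕ.+ a) (desc b a))
  weight-desc-nonZero b a = ℤ.i*j≢0 (Δ (ι (desc b a))) (G (b ℕ.+ a) (desc b a))
    {{subst ℤ.NonZero (sym (Δ-desc b a)) (sf-nonZero b)}}
    {{G-nonZero (b ℕ.+ a) (desc b a) (desc-bounded b a)}}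

  fall-suc : ∀ C x → fall (suc C) x * (+ C - + x) ≡ + C * fall C x
  fall-suc C zero    = eq (+ C)
    where
    eq : ∀ c → 1ℤ * (c - 0ℤ) ≡ c * 1ℤ
    eq = solve-∀
  fall-suc C (suc x) = trans (left (fall (suc C) x) (+ C) (+ x))
    (trans (cong (_* (+ C - 1ℤ - + x)) (fall-suc C x)) (ℤ.*-assoc (+ C) (fall C x) (+ C - 1ℤ - + x)))
    where
    left : ∀ f c x → f * (1ℤ + c - 1ℤ - x) * (c - (1ℤ + x)) ≡ f * (c - x) * (c - 1ℤ - x)
    left = solve-∀

  fall-suc-suc : ∀ C x → fall (suc C) (suc x) ≡ + C * fall C x
  fall-suc-suc C x = trans (eq (fall (suc C) x) (+ C) (+ x)) (fall-suc C x)
    where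
    eq : ∀ f c x → f * (1ℤ + c - 1ℤ - x) ≡ f * (c - x)
    eq = solve-∀

  G-suc : ∀ C l → G (suc C) l * p (ι l) (+ C) ≡ (+ C) ^ length l * G C l
  G-suc C []      = refl
  G-suc C (x ∷ l) = begin
    fall (suc C) x * G (suc C) l * ((+ C - + x) * p (ι l) (+ C))
      ≡⟨ pair (fall (suc C) x) (G (suc C) l) (+ C - + x) (p (ι l) (+ C)) ⟩
    fall (suc C) x * (+ C - + x) * (G (suc C) l * p (ι l) (+ C))
      ≡⟨ cong₂ _*_ (fall-suc C x) (G-suc C l) ⟩
    + C * fall C x * ((+ C) ^ length l * G C l)
      ≡⟨ pair (+ C) (fall C x) ((+ C) ^ length l) (G C l) ⟩
    + C * (+ C) ^ length l * (fall C x * G C l) ∎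
    where
    pair : ∀ a b c d → a * b * (c * d) ≡ a * c * (b * d)
    pair = solve-∀

  rise : ℕ → ℕ → ℕ → ℤ
  rise zero    C n = 1ℤ
  rise (suc k) C n = (+ (k ℕ.+ C)) ^ n * rise k C n

  -- For each entry `x`, the factors `C + j - x` with `j < k` in `R` turn `(k + C - 1 - x)!` in the
  -- denominator into `(C - 1 - x)!`. Thus stacking `k` rows onto a shape changes the weight of the
  -- large rectangle into that of the small one, up to a constant.
  G-rise : ∀ k C l → G (k ℕ.+ C) l * R k C l ≡ rise k C (length l) * G C l
  G-rise zero    C l = trans (ℤ.*-identityʳ (G C l)) (sym (ℤ.*-identityˡ (G C l)))
  G-rise (suc k) C l = begin
    G (suc (k ℕ.+ C)) l * (p (ι l) (+ (k ℕ.+ C)) * R k C l)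
      ≡⟨ ℤ.*-assoc (G (suc (k ℕ.+ C)) l) (p (ι l) (+ (k ℕ.+ C))) (R k C l) ⟨
    G (suc (k ℕ.+ C)) l * p (ι l) (+ (k ℕ.+ C)) * R k C l
      ≡⟨ cong (_* R k C l) (G-suc (k ℕ.+ C) l) ⟩
    (+ (k ℕ.+ C)) ^ length l * G (k ℕ.+ C) l * R k C l
      ≡⟨ ℤ.*-assoc ((+ (k ℕ.+ C)) ^ length l) (G (k ℕ.+ C) l) (R k C l) ⟩
    (+ (k ℕ.+ C)) ^ length l * (G (k ℕ.+ C) l * R k C l)
      ≡⟨ cong (λ t → (+ (k ℕ.+ C)) ^ length l * t) (G-rise k C l) ⟩
    (+ (k ℕ.+ C)) ^ length l * (rise k C (length l) * G C l)
      ≡⟨ ℤ.*-assoc ((+ (k ℕ.+ C)) ^ length l) (rise k C (length l)) (G C l) ⟨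
    (+ (k ℕ.+ C)) ^ length l * rise k C (length l) * G C l ∎

  G-desc-suc : ∀ C b a → G (suc C) (desc b (suc a)) ≡ (+ C) ^ b * G C (desc b a)
  G-desc-suc C zero    a = refl
  G-desc-suc C (suc b) a = trans
    (cong₂ _*_ (trans (cong (fall (suc C)) (ℕ.+-suc b a)) (fall-suc-suc C (b ℕ.+ a))) (G-desc-suc C b a))
    (pair (+ C) (fall C (b ℕ.+ a)) ((+ C) ^ b) (G C (desc b a)))
    where
    pair : ∀ a b c d → a * b * (c * d) ≡ a * c * (b * d)
    pair = solve-∀

  -- The constant of `G-rise` appears again between the top values of the two weights; this is why
  -- it drops out of the final count.
  G-desc-rise : ∀ k C b a → G (k ℕ.+ C) (desc b (k ℕ.+ a)) ≡ rise k C b * G C (desc b a)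
  G-desc-rise zero    C b a = sym (ℤ.*-identityˡ (G C (desc b a)))
  G-desc-rise (suc k) C b a = trans (G-desc-suc (k ℕ.+ C) b (k ℕ.+ a))
    (trans (cong (λ t → (+ (k ℕ.+ C)) ^ b * t) (G-desc-rise k C b a))
      (sym (ℤ.*-assoc ((+ (k ℕ.+ C)) ^ b) (rise k C b) (G C (desc b a)))))

  -- Up to a factor depending on |μ| only, weight (b + c) counts the ways from cᵇ down to μ.
  -- So X s counts the tableaux of aᵇ, by the μ of size s holding their smallest entries;
  -- H s and Y s count the tableaux of the truncated shape whose k a + s smallest entries
  -- fill some (aᵏ⁻¹, a + 1, μ), or some (aᵏ, μ) with the box at the end of row k next.
  module Sums (a b k′ : ℕ) where

    k n A C : ℕ
    k = suc k′
    n = k ℕ.+ a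
    A = b ℕ.+ a
    C = b ℕ.+ n

    C≡k+A : C ≡ k ℕ.+ A
    C≡k+A = eq b k a
      where
      eq : ∀ b k a → b ℕ.+ (k ℕ.+ a) ≡ k ℕ.+ (b ℕ.+ a)
      eq = ℕ-Ring.solve-∀

    A≤C : A ≤ C
    A≤C = subst (A ≤_) (sym C≡k+A) (ℕ.m≤n+m A k)

    X : ℕ → ℤ
    X s = pairing A C b (λ l → #Std s (shape l))

    X-suc : ∀ s → X (suc s) ≡ (+ a * + b - + s) * X s
    X-suc s = trans (pairing-cong A C b (λ l _ _ → #Std-suc s (shape l)))
      (pairing-D a C b s (#Std s) A≤C (#Std-level s))

    κ : ℤ
    κ = weight A (desc b a)

    X-top : X (b ℕ.* a) ≡ κ * #Std (b ℕ.* a) (replicate b a)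
    X-top = trans (pairing-top a C b _ A≤C (λ l _ _ ≢full → #Std-level (b ℕ.* a) (shape l) ≢full))
      (cong (λ t → κ * #Std (b ℕ.* a) t) (shape-desc b a))

    truncated : Shape → Shape
    truncated t = replicate k′ a ++ suc a ∷ t

    sum-truncated : ∀ t → sum (truncated t) ≡ suc (k ℕ.* a ℕ.+ sum t)
    sum-truncated t = trans (sum-replicate-++ k′ a (suc a ∷ t)) (eq (k′ ℕ.* a) a (sum t))
      where
      eq : ∀ x a t → x ℕ.+ (suc a ℕ.+ t) ≡ suc (a ℕ.+ x ℕ.+ t)
      eq = ℕ-Ring.solve-∀

    H : ℕ → ℤ
    H s = pairing C C b (λ l → #Std (k ℕ.* a ℕ.+ s) (truncated (shape l)))

    Y : ℕ → ℤ
    Y s = pairing C C b (λ l → ⟦ All.all? (ℕ._≤? a) (shape l) ⟧ * #Std (k ℕ.* a ℕ.+ s) (replicate k a ++ shape l))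

    H-zero : H 0 ≡ 0ℤ
    H-zero = ∑ᵇ-zero C b (λ l _ → trans (cong (λ t → ⟦ strict? l ⟧ * weight C l * t)
      (#Std-level (k ℕ.* a ℕ.+ 0) (truncated (shape l)) (off l))) (ℤ.*-zeroʳ (⟦ strict? l ⟧ * weight C l)))
      where
      off : ∀ l → sum (truncated (shape l)) ≢ k ℕ.* a ℕ.+ 0
      off l eq = ℕ.<⇒≢ (s≤s (ℕ.m≤m+n (k ℕ.* a) (sum (shape l))))
        (trans (sym (ℕ.+-identityʳ (k ℕ.* a))) (trans (sym eq) (sum-truncated (shape l))))

    -- The largest entry is either at the end of row `k`, which gives `Y s`, or in the lower part.
    -- In the latter case the lower part has `s - 1` boxes after the removal, the box ending row `k`
    -- being one of the `s`, so the eigenvalue is `n * b - (s - 1)`.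
    H-suc : ∀ s → H (suc s) ≡ Y s + (+ n * + b + 1ℤ - + s) * H s
    H-suc s = begin
      H (suc s)
        ≡⟨ pairing-cong C C b (λ l _ _ → trans
             (cong (λ N → #Std N (truncated (shape l))) (ℕ.+-suc (k ℕ.* a) s))
             (trans (#Std-suc (k ℕ.* a ℕ.+ s) (truncated (shape l)))
               (D-truncated (#Std (k ℕ.* a ℕ.+ s)) k′ a (shape l)))) ⟩
      pairing C C b (λ l → ⟦ All.all? (ℕ._≤? a) (shape l) ⟧ * #Std (k ℕ.* a ℕ.+ s) (replicate k a ++ shape l)
        + D (#Std (k ℕ.* a ℕ.+ s) ∘ truncated) (shape l))
        ≡⟨ pairing-+ C C b _ _ ⟩
      Y s + pairing C C b (λ l → D (#Std (k ℕ.* a ℕ.+ s) ∘ truncated) (shape l))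
        ≡⟨ cong₂ _+_ {x = Y s} refl (remaining s) ⟩
      Y s + (+ n * + b + 1ℤ - + s) * H s ∎
      where
      off-level : ∀ s t → suc (sum t) ≢ s → #Std (k ℕ.* a ℕ.+ s) (truncated t) ≡ 0ℤ
      off-level s t ≢s = #Std-level (k ℕ.* a ℕ.+ s) (truncated t) (λ eq → ≢s
        (ℕ.+-cancelˡ-≡ (k ℕ.* a) (suc (sum t)) s
          (trans (ℕ.+-suc (k ℕ.* a) (sum t)) (trans (sym (sum-truncated t)) eq))))
      remaining : ∀ s → pairing C C b (λ l → D (#Std (k ℕ.* a ℕ.+ s) ∘ truncated) (shape l))
        ≡ (+ n * + b + 1ℤ - + s) * H s
      -- There is no level `-1`; both sides are zero since `H 0` is.
      remaining zero = trans (pairing-D n C b 0 _ ℕ.≤-refl (λ t _ → off-level 0 t (λ ())))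
        (trans (trans (cong (λ t → (+ n * + b - 0ℤ) * t) H-zero) (ℤ.*-zeroʳ (+ n * + b - 0ℤ)))
        (sym (trans (cong (λ t → (+ n * + b + 1ℤ - 0ℤ) * t) H-zero) (ℤ.*-zeroʳ (+ n * + b + 1ℤ - 0ℤ)))))
      remaining (suc s) = trans (pairing-D n C b s _ ℕ.≤-refl (λ t ≢s → off-level (suc s) t (≢s ∘ ℕ.suc-injective)))
        (cong (_* H (suc s)) (eq (+ n * + b) (+ s)))
        where
        eq : ∀ x s → x - s ≡ x + 1ℤ - (1ℤ + s)
        eq = solve-∀

    κ′ : ℤ
    κ′ = weight C (desc b n)

    H-top : H (suc (b ℕ.* n)) ≡ κ′ * #Std (k ℕ.* a ℕ.+ suc (b ℕ.* n)) (truncated (replicate b n))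
    H-top = trans (pairing-top n C b _ ℕ.≤-refl (λ l _ _ ≢full → #Std-level _ (truncated (shape l)) (λ eq → ≢full
        (ℕ.suc-injective (ℕ.+-cancelˡ-≡ (k ℕ.* a) (suc (sum (shape l))) (suc (b ℕ.* n))
          (trans (ℕ.+-suc (k ℕ.* a) (sum (shape l))) (trans (sym (sum-truncated (shape l))) eq)))))))
      (cong (λ t → κ′ * #Std (k ℕ.* a ℕ.+ suc (b ℕ.* n)) (truncated t)) (shape-desc b n))

    ρ : ℤ
    ρ = rise k A b

    κ′≡ρκ : κ′ ≡ ρ * κ
    κ′≡ρκ = begin
      Δ (ι (desc b n)) * G C (desc b n)
        ≡⟨ cong₂ _*_ (trans (Δ-desc b n) (sym (Δ-desc b a)))
             (trans (cong (λ c → G c (desc b n)) C≡k+A) (G-desc-rise k A b a)) ⟩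
      Δ (ι (desc b a)) * (ρ * G A (desc b a))
        ≡⟨ eq (Δ (ι (desc b a))) ρ (G A (desc b a)) ⟩
      ρ * κ ∎
      where
      eq : ∀ x y z → x * (y * z) ≡ y * (x * z)
      eq = solve-∀

    -- Multiplied by `F l`, this compares the hook length formulas of `desc k A ++ l` and of `l`. Of
    -- the two factors `Δ (ι l)` on the left, one goes into the count of tableaux of `shape l` and
    -- the other into the weight, which `G-rise` takes from `C` to `A`.
    removed-corner : ∀ s l → length l ≡ b → Strict l →
      weight C l * (⟦ All.all? (ℕ._≤? a) (shape l) ⟧ * #Std (k ℕ.* a ℕ.+ s) (replicate k a ++ shape l))
        * (F (desc k A) * + (s !))
      ≡ + ((k ℕ.* a ℕ.+ s) !) * sf k * ρ * (weight A l * #Std s (shape l))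
    removed-corner s l refl st with sum (shape l) ℕ.≟ s
    ... | no ≢s = trans
      (cong (λ t → weight C l * (⟦ All.all? (ℕ._≤? a) (shape l) ⟧ * t) * (F (desc k A) * + (s !)))
        (#Std-level (k ℕ.* a ℕ.+ s) (replicate k a ++ shape l) (λ eq → ≢s (ℕ.+-cancelˡ-≡ (k ℕ.* a) _ _
          (trans (sym (sum-replicate-++ k a (shape l))) eq)))))
      (trans (vanish (weight C l) ⟦ All.all? (ℕ._≤? a) (shape l) ⟧ (F (desc k A) * + (s !)) (+ ((k ℕ.* a ℕ.+ s) !) * sf k * ρ) (weight A l))
        (cong (λ t → + ((k ℕ.* a ℕ.+ s) !) * sf k * ρ * (weight A l * t)) (sym (#Std-level s (shape l) ≢s))))
      where
      vanish : ∀ w i f e v → w * (i * 0ℤ) * f ≡ e * (v * 0ℤ)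
      vanish = solve-∀
    ... | yes refl with All.all? (ℕ._<? A) l
    -- Some row is longer than `a`: the indicator is zero on the left, the weight on the right.
    ... | no ¬all = trans
      (cong (λ t → weight C l * (t * #Std (k ℕ.* a ℕ.+ s) (replicate k a ++ shape l)) * (F (desc k A) * + (s !)))
        (⟦⟧-no (All.all? (ℕ._≤? a) (shape l)) (λ all≤ → ¬all (shape-bounded⁻ l st (ℕ.m≤m+n (length l) a)
          (All.map (λ {x} → subst (x ≤_) (sym (ℕ.m+n∸m≡n (length l) a))) all≤)))))
      (trans (vanish (weight C l) (#Std (k ℕ.* a ℕ.+ s) (replicate k a ++ shape l)) (F (desc k A) * + (s !)) (+ ((k ℕ.* a ℕ.+ s) !) * sf k * ρ) (#Std s (shape l)))
        (cong (λ t → + ((k ℕ.* a ℕ.+ s) !) * sf k * ρ * (t * #Std s (shape l)))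
          (sym (weight-zero a l (Any.map ℕ.≮⇒≥ (All.¬All⇒Any¬ (ℕ._<? A) l ¬all))))))
      where
      vanish : ∀ w f g e v → w * (0ℤ * f) * g ≡ e * (0ℤ * v)
      vanish = solve-∀
    ... | yes all = ℤ.*-cancelʳ-≡ _ _ (F l) {{F-nonZero l}} (begin
      weight C l * (⟦ All.all? (ℕ._≤? a) (shape l) ⟧ * f₁) * (F (desc k A) * s!) * F l
        ≡⟨ cong (λ t → weight C l * (t * f₁) * (F (desc k A) * s!) * F l)
             (⟦⟧-yes (All.all? (ℕ._≤? a) (shape l)) (All.map (λ {x} → subst (x ≤_) (ℕ.m+n∸m≡n (length l) a)) (shape-bounded l st all))) ⟩
      d * G C l * (1ℤ * f₁) * (F (desc k A) * s!) * F l
        ≡⟨ rearrange₁ d (G C l) f₁ (F (desc k A)) s! (F l) ⟩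
      d * G C l * s! * (f₁ * (F (desc k A) * F l))
        ≡⟨ cong (λ t → d * G C l * s! * t) hook₁ ⟩
      d * G C l * s! * (N! * (sf k * R k A l * d))
        ≡⟨ rearrange₂ d (G C l) s! N! (sf k) (R k A l) ⟩
      N! * sf k * (G C l * R k A l) * d * (s! * d)
        ≡⟨ cong₂ (λ x y → N! * sf k * x * d * y)
             (trans (cong (λ c → G c l * R k A l) C≡k+A) (G-rise k A l)) (sym (hook s l st refl)) ⟩
      N! * sf k * (ρ * G A l) * d * (#Std s (shape l) * F l)
        ≡⟨ rearrange₃ N! (sf k) ρ (G A l) d (#Std s (shape l)) (F l) ⟩
      N! * sf k * ρ * (d * G A l * #Std s (shape l)) * F l ∎)
      where
      d  = Δ (ι l)
      s! = + (s !)
      N! = + ((k ℕ.* a ℕ.+ s) !)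
      f₁ = #Std (k ℕ.* a ℕ.+ s) (replicate k a ++ shape l)
      shape≡ : shape (desc k A ++ l) ≡ replicate k a ++ shape l
      shape≡ = shape-desc-++ k a l
      hook₁ : f₁ * (F (desc k A) * F l) ≡ N! * (sf k * R k A l * d)
      hook₁ = begin
        f₁ * (F (desc k A) * F l)
          ≡⟨ cong₂ (λ t u → #Std (k ℕ.* a ℕ.+ s) t * u) (sym shape≡) (sym (F-++ (desc k A) l)) ⟩
        #Std (k ℕ.* a ℕ.+ s) (shape (desc k A ++ l)) * F (desc k A ++ l)
          ≡⟨ hook (k ℕ.* a ℕ.+ s) (desc k A ++ l) (desc-++-strict k A l st all)
               (trans (cong sum shape≡) (sum-replicate-++ k a (shape l))) ⟩
        N! * Δ (ι (desc k A ++ l))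
          ≡⟨ cong (λ t → N! * t) (Δ-desc-++ k A l) ⟩
        N! * (sf k * R k A l * d) ∎
      rearrange₁ : ∀ d g f x s y → d * g * (1ℤ * f) * (x * s) * y ≡ d * g * s * (f * (x * y))
      rearrange₁ = solve-∀
      rearrange₂ : ∀ d g s n x r → d * g * s * (n * (x * r * d)) ≡ n * x * (g * r) * d * (s * d)
      rearrange₂ = solve-∀
      rearrange₃ : ∀ n x r g d f y → n * x * (r * g) * d * (f * y) ≡ n * x * r * (d * g * f) * y
      rearrange₃ = solve-∀

    Y≡X : ∀ s → Y s * (F (desc k A) * + (s !)) ≡ + ((k ℕ.* a ℕ.+ s) !) * sf k * ρ * X s
    Y≡X s = begin
      Y s * c
        ≡⟨ ℤ.*-comm (Y s) c ⟩
      c * Y s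
        ≡⟨ sym (∑ᵇ-* C b c _) ⟩
      ∑ᵇ C b (λ l → c * (⟦ strict? l ⟧ * weight C l * y l))
        ≡⟨ ∑ᵇ-cong C b pointwise ⟩
      ∑ᵇ C b (λ l → e * (⟦ strict? l ⟧ * weight A l * #Std s (shape l)))
        ≡⟨ ∑ᵇ-* C b e _ ⟩
      e * X s ∎
      where
      c = F (desc k A) * + (s !)
      e = + ((k ℕ.* a ℕ.+ s) !) * sf k * ρ
      y : List ℕ → ℤ
      y l = ⟦ All.all? (ℕ._≤? a) (shape l) ⟧ * #Std (k ℕ.* a ℕ.+ s) (replicate k a ++ shape l)
      swap : ∀ c w y → c * (1ℤ * w * y) ≡ w * y * c
      swap = solve-∀
      pointwise : ∀ l → length l ≡ b →
        c * (⟦ strict? l ⟧ * weight C l * y l) ≡ e * (⟦ strict? l ⟧ * weight A l * #Std s (shape l))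
      pointwise l len with strict? l
      ... | no _   = trans (ℤ.*-zeroʳ c) (sym (ℤ.*-zeroʳ e))
      ... | yes st = trans (swap c (weight C l) (y l)) (trans (removed-corner s l len st)
              (cong (λ t → e * (t * #Std s (shape l))) (sym (ℤ.*-identityˡ (weight A l)))))

-- Binomial coefficients and factorials

open import Data.Nat.Combinatorics using (_C_; nCk≡n!/k![n-k]!; k![n∸k]!∣n!)

-- The binomial coefficient of `p + s` over `s`, which is the coefficient of `x^s` in
-- `(1 - x)^(-(p + 1))`. Pascal's rule in this indexing involves no subtraction.
multichoose : ℕ → ℕ → ℕ
multichoose zero    s       = 1
multichoose (suc p) zero    = 1
multichoose (suc p) (suc s) = multichoose p (suc s) ℕ.+ multichoose (suc p) s

multichoose-zero : ∀ p → multichoose p 0 ≡ 1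
multichoose-zero zero    = refl
multichoose-zero (suc p) = refl

multichoose-! : ∀ p s → multichoose p s ℕ.* (p ! ℕ.* s !) ≡ (p ℕ.+ s) !
multichoose-! zero    s       = eq (s !)
  where
  eq : ∀ x → 1 ℕ.* (1 ℕ.* x) ≡ x
  eq = ℕ-Ring.solve-∀
multichoose-! (suc p) zero    = trans (eq (suc p !)) (cong _! (sym (ℕ.+-identityʳ (suc p))))
  where
  eq : ∀ x → 1 ℕ.* (x ℕ.* 1) ≡ x
  eq = ℕ-Ring.solve-∀
multichoose-! (suc p) (suc s) = begin
  (x ℕ.+ y) ℕ.* (suc p ℕ.* p ! ℕ.* (suc s ℕ.* s !))
    ≡⟨ split x y (suc p) (p !) (suc s) (s !) ⟩
  suc p ℕ.* (x ℕ.* (p ! ℕ.* (suc s ℕ.* s !))) ℕ.+ suc s ℕ.* (y ℕ.* (suc p ℕ.* p ! ℕ.* s !))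
    ≡⟨ cong₂ (λ u v → suc p ℕ.* u ℕ.+ suc s ℕ.* v) (multichoose-! p (suc s)) (multichoose-! (suc p) s) ⟩
  suc p ℕ.* (p ℕ.+ suc s) ! ℕ.+ suc s ℕ.* (suc p ℕ.+ s) !
    ≡⟨ cong (λ u → suc p ℕ.* (p ℕ.+ suc s) ! ℕ.+ suc s ℕ.* u !) (sym (ℕ.+-suc p s)) ⟩
  suc p ℕ.* (p ℕ.+ suc s) ! ℕ.+ suc s ℕ.* (p ℕ.+ suc s) !
    ≡⟨ sym (ℕ.*-distribʳ-+ ((p ℕ.+ suc s) !) (suc p) (suc s)) ⟩
  (suc p ℕ.+ suc s) ! ∎
  where
  open ≡-Reasoning
  x = multichoose p (suc s)
  y = multichoose (suc p) s
  split : ∀ x y p p! s s! → (x ℕ.+ y) ℕ.* (p ℕ.* p! ℕ.* (s ℕ.* s!))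
    ≡ p ℕ.* (x ℕ.* (p! ℕ.* (s ℕ.* s!))) ℕ.+ s ℕ.* (y ℕ.* (p ℕ.* p! ℕ.* s!))
  split = ℕ-Ring.solve-∀

C-! : ∀ p q → ((p ℕ.+ q) C p) ℕ.* (p ! ℕ.* q !) ≡ (p ℕ.+ q) !
C-! p q = begin
  ((p ℕ.+ q) C p) ℕ.* (p ! ℕ.* q !)
    ≡⟨ cong (λ r → ((p ℕ.+ q) C p) ℕ.* (p ! ℕ.* r !)) (sym (ℕ.m+n∸m≡n p q)) ⟩
  ((p ℕ.+ q) C p) ℕ.* (p ! ℕ.* (p ℕ.+ q ℕ.∸ p) !)
    ≡⟨ cong (ℕ._* (p ! ℕ.* (p ℕ.+ q ℕ.∸ p) !)) (nCk≡n!/k![n-k]! (ℕ.m≤m+n p q)) ⟩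
  ((p ℕ.+ q) ! ℕ./ (p ! ℕ.* (p ℕ.+ q ℕ.∸ p) !)) {{nz}} ℕ.* (p ! ℕ.* (p ℕ.+ q ℕ.∸ p) !)
    ≡⟨ m/n*n≡m {{nz}} (k![n∸k]!∣n! (ℕ.m≤m+n p q)) ⟩
  (p ℕ.+ q) ! ∎
  where
  open ≡-Reasoning
  nz = p ℕ.!* (p ℕ.+ q ℕ.∸ p) !≢0

/1≡/ : ∀ p q d .{{_ : ℕ.NonZero d}} → p ℕ.* d ≡ q → + p / 1 ≡ + q / d
/1≡/ p q (suc d) eq = ℚ.fromℚᵘ-cong {ℚᵘ.mkℚᵘ (+ p) 0} {ℚᵘ.mkℚᵘ (+ q) d} (ℚᵘ.*≡*
  (trans (sym (ℤ.pos-* p (suc d))) (trans (cong +_ eq) (sym (ℤ.*-identityʳ (+ q))))))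

-- Solution of the recurrences and the product formula

module _ where
  open import Data.Integer.Base using (_+_; _*_; _-_; -_)
  open ≡-Reasoning

  ∑-truncate : ∀ m j {f : ℕ → ℤ} → (∀ i → f (m ℕ.+ i) ≡ 0ℤ) → ∑ (m ℕ.+ j) f ≡ ∑ m f
  ∑-truncate m zero    {f} eq = cong (λ n → ∑ n f) (ℕ.+-identityʳ m)
  ∑-truncate m (suc j) {f} eq = trans (cong (λ n → ∑ n f) (ℕ.+-suc m j))
    (trans (cong₂ _+_ (∑-truncate m j eq) (eq j)) (ℤ.+-identityʳ (∑ m f)))

  mc : ℕ → ℕ → ℤ
  mc p s = + multichoose p s

  mc-suc : ∀ p s → mc (suc p) (suc s) ≡ mc p (suc s) + mc (suc p) s
  mc-suc p s = ℤ.pos-+ (multichoose p (suc s)) (multichoose (suc p) s)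

  -- Coefficients of `x^r` in the product of `(1 - x)^(-(p + 1))` and `(1 - x)^(-(q + 1))`; the
  -- exponents add up to `p + q + 2`, hence the index `suc (p + q)`.
  vandermonde : ∀ p q r → ∑ (suc r) (λ s → mc p s * mc q (r ℕ.∸ s)) ≡ mc (suc (p ℕ.+ q)) r
  vandermonde p zero r = trans (∑-cong (suc r) (λ s _ → ℤ.*-identityʳ (mc p s)))
    (trans (hockeystick r) (cong (λ m → mc (suc m) r) (sym (ℕ.+-identityʳ p))))
    where
    hockeystick : ∀ r → ∑ (suc r) (mc p) ≡ mc (suc p) r
    hockeystick zero    = trans (ℤ.+-identityˡ (mc p 0)) (cong (λ m → + m) (multichoose-zero p))
    hockeystick (suc r) = trans (cong (_+ mc p (suc r)) (hockeystick r))
      (trans (ℤ.+-comm (mc (suc p) r) (mc p (suc r))) (sym (mc-suc p r)))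
  vandermonde p (suc q) zero = trans (ℤ.+-identityˡ (mc p 0 * 1ℤ))
    (trans (ℤ.*-identityʳ (mc p 0)) (cong (λ m → + m) (multichoose-zero p)))
  vandermonde p (suc q) (suc r) = begin
    ∑ (suc r) (λ s → mc p s * mc (suc q) (suc r ℕ.∸ s)) + mc p (suc r) * mc (suc q) (r ℕ.∸ r)
      ≡⟨ cong₂ _+_
           (trans (∑-cong (suc r) (λ s s≤r → split s (ℕ.s≤s⁻¹ s≤r))) (∑-+ (suc r) _ _))
           -- The last term has `mc (suc q) 0 = mc q 0`, so it completes the sum belonging to `q`.
           (cong (λ m → mc p (suc r) * m) (trans (cong (mc (suc q)) (ℕ.n∸n≡0 r))
             (trans (cong (λ m → + m) (sym (multichoose-zero q))) (cong (mc q) (sym (ℕ.n∸n≡0 r)))))) ⟩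
    ∑ (suc r) (λ s → mc p s * mc q (suc r ℕ.∸ s)) + ∑ (suc r) (λ s → mc p s * mc (suc q) (r ℕ.∸ s)) + last
      ≡⟨ regroup (∑ (suc r) (λ s → mc p s * mc q (suc r ℕ.∸ s))) (∑ (suc r) (λ s → mc p s * mc (suc q) (r ℕ.∸ s))) last ⟩
    ∑ (suc r) (λ s → mc p s * mc q (suc r ℕ.∸ s)) + last + ∑ (suc r) (λ s → mc p s * mc (suc q) (r ℕ.∸ s))
      ≡⟨ cong₂ _+_ (vandermonde p q (suc r)) (vandermonde p (suc q) r) ⟩
    mc (suc (p ℕ.+ q)) (suc r) + mc (suc (p ℕ.+ suc q)) r
      ≡⟨ cong₂ (λ u v → mc u (suc r) + mc (suc v) r) (sym (ℕ.+-suc p q)) refl ⟩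
    mc (p ℕ.+ suc q) (suc r) + mc (suc (p ℕ.+ suc q)) r
      ≡⟨ sym (mc-suc (p ℕ.+ suc q) r) ⟩
    mc (suc (p ℕ.+ suc q)) (suc r) ∎
    where
    last = mc p (suc r) * mc q (r ℕ.∸ r)
    split : ∀ s → s ≤ r → mc p s * mc (suc q) (suc r ℕ.∸ s)
      ≡ mc p s * mc q (suc r ℕ.∸ s) + mc p s * mc (suc q) (r ℕ.∸ s)
    split s s≤r rewrite ℕ.+-∸-assoc 1 s≤r = trans (cong (λ m → mc p s * m) (mc-suc q (r ℕ.∸ s)))
      (ℤ.*-distribˡ-+ (mc p s) (mc q (suc (r ℕ.∸ s))) (mc (suc q) (r ℕ.∸ s)))
    regroup : ∀ a b c → a + b + c ≡ a + c + b
    regroup = solve-∀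

  !-multichoose : ∀ p s → + ((p ℕ.+ s) !) ≡ mc p s * (+ (p !) * + (s !))
  !-multichoose p s = trans (cong (λ m → + m) (sym (multichoose-! p s)))
    (trans (ℤ.pos-* (multichoose p s) (p ! ℕ.* s !)) (cong (λ m → mc p s * m) (ℤ.pos-* (p !) (s !))))

  -- The product of the factorials of the coordinates is `sf (b + a) / sf a`; clearing the quotient
  -- gives a form symmetric in the two sides apart from the count itself.
  rectangle : ∀ b a → + #SYT (replicate b a) * sf (b ℕ.+ a) ≡ + ((b ℕ.* a) !) * sf b * sf a
  rectangle b a = begin
    + #SYT (replicate b a) * sf (b ℕ.+ a)
      ≡⟨ cong₂ _*_ (trans (#SYT≡#Std (replicate b a)) (cong (λ N → #Std N (replicate b a)) (sum-replicate b a)))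
           (sym (F-desc b a)) ⟩
    #Std (b ℕ.* a) (replicate b a) * (F (desc b a) * sf a)
      ≡⟨ sym (ℤ.*-assoc (#Std (b ℕ.* a) (replicate b a)) (F (desc b a)) (sf a)) ⟩
    #Std (b ℕ.* a) (replicate b a) * F (desc b a) * sf a
      ≡⟨ cong (λ s → #Std (b ℕ.* a) s * F (desc b a) * sf a) (sym (shape-desc b a)) ⟩
    #Std (b ℕ.* a) (shape (desc b a)) * F (desc b a) * sf a
      ≡⟨ cong (_* sf a) (hook (b ℕ.* a) (desc b a) (desc-strict b a) (trans (cong sum (shape-desc b a)) (sum-replicate b a))) ⟩
    + ((b ℕ.* a) !) * Δ (ι (desc b a)) * sf a
      ≡⟨ cong (λ x → + ((b ℕ.* a) !) * x * sf a) (Δ-desc b a) ⟩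
    + ((b ℕ.* a) !) * sf b * sf a ∎

  module Count (a b k′ : ℕ) where
    open Sums a b k′

    private
      E : ℤ
      E = sf k * ρ

    X-coefficient : ∀ s t → s ℕ.+ t ≡ b ℕ.* a → + a * + b - + s ≡ + t
    X-coefficient s t eq = begin
      + a * + b - + s        ≡⟨ cong (_- + s) (trans (sym (ℤ.pos-* a b)) (cong (λ m → + m) (trans (ℕ.*-comm a b) (sym eq)))) ⟩
      + (s ℕ.+ t) - + s      ≡⟨ cong (λ m → + m - + s) (ℕ.+-comm s t) ⟩
      + (t ℕ.+ s) - + s      ≡⟨ pos-difference t s ⟩
      + t                    ∎

    X-rise : ∀ t s → s ℕ.+ t ≡ b ℕ.* a → X (b ℕ.* a) ≡ + (t !) * X s
    X-rise zero    s eq = trans (cong X (trans (sym eq) (ℕ.+-identityʳ s))) (sym (ℤ.*-identityˡ (X s)))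
    X-rise (suc t) s eq = begin
      X (b ℕ.* a)                        ≡⟨ X-rise t (suc s) (trans (sym (ℕ.+-suc s t)) eq) ⟩
      + (t !) * X (suc s)                ≡⟨ cong (λ x → + (t !) * x) (trans (X-suc s) (cong (_* X s) (X-coefficient s (suc t) eq))) ⟩
      + (t !) * (+ suc t * X s)          ≡⟨ rearrange (+ (t !)) (+ suc t) (X s) ⟩
      + suc t * + (t !) * X s            ≡⟨ cong (_* X s) (sym (ℤ.pos-* (suc t) (t !))) ⟩
      + (suc t !) * X s                  ∎
      where
      rearrange : ∀ x y z → x * (y * z) ≡ y * x * z
      rearrange = solve-∀

    -- The coefficient of the step from level `b * a` is zero, and every later value is a multiple
    -- of the one obtained there.
    X-vanish : ∀ j → X (suc (b ℕ.* a) ℕ.+ j) ≡ 0ℤ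
    X-vanish zero    = trans (cong (λ s → X (suc s)) (ℕ.+-identityʳ (b ℕ.* a)))
      (trans (X-suc (b ℕ.* a)) (cong (_* X (b ℕ.* a)) (X-coefficient (b ℕ.* a) 0 (ℕ.+-identityʳ (b ℕ.* a)))))
    X-vanish (suc j) = trans (cong (λ s → X (suc s)) (ℕ.+-suc (b ℕ.* a) j))
      (trans (X-suc (suc (b ℕ.* a) ℕ.+ j)) (trans (cong (λ x → (+ a * + b - + (suc (b ℕ.* a) ℕ.+ j)) * x) (X-vanish j))
        (ℤ.*-zeroʳ (+ a * + b - + (suc (b ℕ.* a) ℕ.+ j)))))

    T : ℕ
    T = b ℕ.* n

    T≡ : T ≡ b ℕ.* a ℕ.+ k ℕ.* b
    T≡ = eq b k a
      where
      eq : ∀ b k a → b ℕ.* (k ℕ.+ a) ≡ b ℕ.* a ℕ.+ k ℕ.* b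
      eq = ℕ-Ring.solve-∀

    -- Multiplication by `t !` absorbs the coefficient `t + 1` of the recurrence, so the left side
    -- grows by one term of the sum at each step.
    H-sum : ∀ s t → s ℕ.+ t ≡ T → + (t !) * H (suc s) ≡ ∑ (suc s) (λ r → Y r * + ((T ℕ.∸ r) !))
    H-sum zero t refl = begin
      + (T !) * H 1                                     ≡⟨ cong (λ x → + (T !) * x) (trans (H-suc 0) (cong (λ x → Y 0 + (+ n * + b + 1ℤ - 0ℤ) * x) H-zero)) ⟩
      + (T !) * (Y 0 + (+ n * + b + 1ℤ - 0ℤ) * 0ℤ)      ≡⟨ eq (+ (T !)) (Y 0) (+ n * + b + 1ℤ - 0ℤ) ⟩
      0ℤ + Y 0 * + (T !)                                ∎
      where
      eq : ∀ t y c → t * (y + c * 0ℤ) ≡ 0ℤ + y * t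
      eq = solve-∀
    H-sum (suc s) t eq = begin
      + (t !) * H (suc (suc s))
        ≡⟨ cong (λ x → + (t !) * x) (trans (H-suc (suc s)) (cong (λ c → Y (suc s) + c * H (suc s)) coefficient)) ⟩
      + (t !) * (Y (suc s) + + suc t * H (suc s))
        ≡⟨ rearrange (+ (t !)) (Y (suc s)) (+ suc t) (H (suc s)) ⟩
      + suc t * + (t !) * H (suc s) + Y (suc s) * + (t !)
        ≡⟨ cong₂ (λ u v → u * H (suc s) + Y (suc s) * + (v !)) (sym (ℤ.pos-* (suc t) (t !)))
             (sym (trans (cong (ℕ._∸ suc s) (sym eq)) (ℕ.m+n∸m≡n (suc s) t))) ⟩
      + (suc t !) * H (suc s) + Y (suc s) * + ((T ℕ.∸ suc s) !)
        ≡⟨ cong (_+ Y (suc s) * + ((T ℕ.∸ suc s) !)) (H-sum s (suc t) (trans (ℕ.+-suc s t) eq)) ⟩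
      ∑ (suc (suc s)) (λ r → Y r * + ((T ℕ.∸ r) !)) ∎
      where
      rearrange : ∀ t y c h → t * (y + c * h) ≡ c * t * h + y * t
      rearrange = solve-∀
      shift : ∀ s t → (1ℤ + s) + t + 1ℤ - (1ℤ + s) ≡ 1ℤ + t
      shift = solve-∀
      coefficient : + n * + b + 1ℤ - + suc s ≡ + suc t
      coefficient = begin
        + n * + b + 1ℤ - + suc s       ≡⟨ cong (λ m → m + 1ℤ - + suc s) (trans (sym (ℤ.pos-* n b)) (cong (λ m → + m) (trans (ℕ.*-comm n b) (sym eq)))) ⟩
        + (suc s ℕ.+ t) + 1ℤ - + suc s ≡⟨ cong (λ m → m + 1ℤ - + suc s) (ℤ.pos-+ (suc s) t) ⟩
        + suc s + + t + 1ℤ - + suc s   ≡⟨ shift (+ s) (+ t) ⟩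
        + suc t                        ∎

    private
      K : ℤ
      K = F (desc k A)

      E′ : ℤ
      E′ = E * X (b ℕ.* a) * + ((k ℕ.* a) !) * + ((k ℕ.* b) !)

    -- Splitting `(k a + s)!` and `(T - s)!` by `multichoose` releases `s!` and `t!`. The first
    -- cancels the one in `Y≡X`, the second turns `X s` into its top value by `X-rise`, and only the
    -- two multichoose numbers still depend on `s`.
    Y-term : ∀ s → s ≤ b ℕ.* a →
      K * (Y s * + ((T ℕ.∸ s) !)) ≡ E′ * (mc (k ℕ.* a) s * mc (k ℕ.* b) (b ℕ.* a ℕ.∸ s))
    Y-term s s≤ba = ℤ.*-cancelʳ-≡ (K * (Y s * + ((T ℕ.∸ s) !))) (E′ * (mc (k ℕ.* a) s * mc (k ℕ.* b) (b ℕ.* a ℕ.∸ s))) (+ (s !)) {{ !-nonZero s }} (begin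
      K * (Y s * + ((T ℕ.∸ s) !)) * + (s !)
        ≡⟨ cong (λ m → K * (Y s * + (m !)) * + (s !)) T∸s ⟩
      K * (Y s * + ((k ℕ.* b ℕ.+ t) !)) * + (s !)
        ≡⟨ rearrange₁ K (Y s) (+ ((k ℕ.* b ℕ.+ t) !)) (+ (s !)) ⟩
      Y s * (K * + (s !)) * + ((k ℕ.* b ℕ.+ t) !)
        ≡⟨ cong₂ _*_ (Y≡X s) (!-multichoose (k ℕ.* b) t) ⟩
      + ((k ℕ.* a ℕ.+ s) !) * sf k * ρ * X s * (mc (k ℕ.* b) t * (+ ((k ℕ.* b) !) * + (t !)))
        ≡⟨ cong (λ m → m * sf k * ρ * X s * (mc (k ℕ.* b) t * (+ ((k ℕ.* b) !) * + (t !)))) (!-multichoose (k ℕ.* a) s) ⟩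
      mc (k ℕ.* a) s * (+ ((k ℕ.* a) !) * + (s !)) * sf k * ρ * X s * (mc (k ℕ.* b) t * (+ ((k ℕ.* b) !) * + (t !)))
        ≡⟨ rearrange₂ (mc (k ℕ.* a) s) (+ ((k ℕ.* a) !)) (+ (s !)) (sf k) ρ (X s) (mc (k ℕ.* b) t) (+ ((k ℕ.* b) !)) (+ (t !)) ⟩
      E * (+ (t !) * X s) * + ((k ℕ.* a) !) * + ((k ℕ.* b) !) * (mc (k ℕ.* a) s * mc (k ℕ.* b) t) * + (s !)
        ≡⟨ cong (λ x → E * x * + ((k ℕ.* a) !) * + ((k ℕ.* b) !) * (mc (k ℕ.* a) s * mc (k ℕ.* b) t) * + (s !))
             (sym (X-rise t s (ℕ.m+[n∸m]≡n s≤ba))) ⟩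
      E′ * (mc (k ℕ.* a) s * mc (k ℕ.* b) t) * + (s !) ∎)
      where
      t = b ℕ.* a ℕ.∸ s
      T∸s : T ℕ.∸ s ≡ k ℕ.* b ℕ.+ t
      T∸s = trans (cong (ℕ._∸ s) (trans T≡ (ℕ.+-comm (b ℕ.* a) (k ℕ.* b)))) (ℕ.+-∸-assoc (k ℕ.* b) s≤ba)
      rearrange₁ : ∀ k y t s → k * (y * t) * s ≡ y * (k * s) * t
      rearrange₁ = solve-∀
      rearrange₂ : ∀ m x s f r z m′ y t →
        m * (x * s) * f * r * z * (m′ * (y * t)) ≡ f * r * (t * z) * x * y * (m * m′) * s
      rearrange₂ = solve-∀

    Y-vanish : ∀ j → Y (suc (b ℕ.* a) ℕ.+ j) ≡ 0ℤ
    Y-vanish j = ℤ.*-cancelʳ-≡ (Y s) 0ℤ (K * + (s !))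
      {{ℤ.i*j≢0 K (+ (s !)) {{F-nonZero (desc k A)}} {{ !-nonZero s }} }}
      (trans (Y≡X s) (trans (cong (λ x → + ((k ℕ.* a ℕ.+ s) !) * sf k * ρ * x) (X-vanish j))
        (ℤ.*-zeroʳ (+ ((k ℕ.* a ℕ.+ s) !) * sf k * ρ))))
      where
      s = suc (b ℕ.* a) ℕ.+ j

    H-total : K * H (suc T) ≡ E′ * mc (suc (k ℕ.* a ℕ.+ k ℕ.* b)) (b ℕ.* a)
    H-total = begin
      K * H (suc T)
        ≡⟨ cong (λ x → K * x) (trans (sym (ℤ.*-identityˡ (H (suc T)))) (H-sum T 0 (ℕ.+-identityʳ T))) ⟩
      K * ∑ (suc T) (λ r → Y r * + ((T ℕ.∸ r) !))
        ≡⟨ cong (λ m → K * ∑ (suc m) (λ r → Y r * + ((T ℕ.∸ r) !))) T≡ ⟩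
      K * ∑ (suc (b ℕ.* a) ℕ.+ k ℕ.* b) (λ r → Y r * + ((T ℕ.∸ r) !))
        -- Beyond `b * a` the upper-left piece `(aᵏ, μ)` would need a `μ` larger than `aᵇ`.
        ≡⟨ cong (λ x → K * x) (∑-truncate (suc (b ℕ.* a)) (k ℕ.* b)
             (λ j → cong (_* + ((T ℕ.∸ (suc (b ℕ.* a) ℕ.+ j)) !)) (Y-vanish j))) ⟩
      K * ∑ (suc (b ℕ.* a)) (λ r → Y r * + ((T ℕ.∸ r) !))
        ≡⟨ sym (∑-* (suc (b ℕ.* a)) K _) ⟩
      ∑ (suc (b ℕ.* a)) (λ r → K * (Y r * + ((T ℕ.∸ r) !)))
        ≡⟨ ∑-cong (suc (b ℕ.* a)) (λ r r≤ → Y-term r (ℕ.s≤s⁻¹ r≤)) ⟩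
      ∑ (suc (b ℕ.* a)) (λ r → E′ * (mc (k ℕ.* a) r * mc (k ℕ.* b) (b ℕ.* a ℕ.∸ r)))
        ≡⟨ ∑-* (suc (b ℕ.* a)) E′ _ ⟩
      E′ * ∑ (suc (b ℕ.* a)) (λ r → mc (k ℕ.* a) r * mc (k ℕ.* b) (b ℕ.* a ℕ.∸ r))
        ≡⟨ cong (λ x → E′ * x) (vandermonde (k ℕ.* a) (k ℕ.* b) (b ℕ.* a)) ⟩
      E′ * mc (suc (k ℕ.* a ℕ.+ k ℕ.* b)) (b ℕ.* a) ∎

    target : Shape
    target = truncated (replicate b n)

    sum-target : sum target ≡ k ℕ.* a ℕ.+ suc T
    sum-target = trans (sum-truncated (replicate b n)) (trans
      (cong (λ m → suc (k ℕ.* a ℕ.+ m)) (sum-replicate b n)) (sym (ℕ.+-suc (k ℕ.* a) T)))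

    private
      ka! kb! ba! M : ℤ
      ka! = + ((k ℕ.* a) !)
      kb! = + ((k ℕ.* b) !)
      ba! = + ((b ℕ.* a) !)
      M   = mc (suc (k ℕ.* a ℕ.+ k ℕ.* b)) (b ℕ.* a)

    target-count : + #SYT target * sf (k ℕ.+ A) ≡ sf k * (ba! * sf b * sf a) * ka! * kb! * M
    target-count = begin
      + #SYT target * sf (k ℕ.+ A)
        ≡⟨ cong (λ x → + #SYT target * x) (sym (F-desc k A)) ⟩
      + #SYT target * (K * sf A)
        ≡⟨ swap (+ #SYT target) K (sf A) ⟩
      + #SYT target * K * sf A
        -- The factor `κ′` from the top value of `H` equals `ρ * κ`, with `ρ` from `Y≡X` and `κ`
        -- from the top value of `X`.
        ≡⟨ cong (_* sf A) (ℤ.*-cancelʳ-≡ (+ #SYT target * K) (sf k * f * ka! * kb! * M) κ′ {{weight-desc-nonZero b n}} cancelled) ⟩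
      sf k * f * ka! * kb! * M * sf A
        ≡⟨ pull (sf k) f ka! kb! M (sf A) ⟩
      sf k * (f * sf A) * ka! * kb! * M
        ≡⟨ cong (λ x → sf k * x * ka! * kb! * M) (rectangle b a) ⟩
      sf k * (ba! * sf b * sf a) * ka! * kb! * M ∎
      where
      f = + #SYT (replicate b a)
      swap : ∀ x y z → x * (y * z) ≡ x * y * z
      swap = solve-∀
      pull : ∀ s f x y m z → s * f * x * y * m * z ≡ s * (f * z) * x * y * m
      pull = solve-∀
      reorder : ∀ t k w → t * k * w ≡ k * (w * t)
      reorder = solve-∀
      collect : ∀ s r w f x y m → s * r * (w * f) * x * y * m ≡ s * f * x * y * m * (r * w)
      collect = solve-∀
      cancelled : + #SYT target * K * κ′ ≡ sf k * f * ka! * kb! * M * κ′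
      cancelled = begin
        + #SYT target * K * κ′
          ≡⟨ reorder (+ #SYT target) K κ′ ⟩
        K * (κ′ * + #SYT target)
          ≡⟨ cong (λ x → K * (κ′ * x)) (trans (#SYT≡#Std target) (cong (λ N → #Std N target) sum-target)) ⟩
        K * (κ′ * #Std (k ℕ.* a ℕ.+ suc T) target)
          ≡⟨ cong (λ x → K * x) (sym H-top) ⟩
        K * H (suc T)
          ≡⟨ H-total ⟩
        sf k * ρ * X (b ℕ.* a) * ka! * kb! * M
          ≡⟨ cong (λ x → sf k * ρ * x * ka! * kb! * M) (trans X-top (cong (λ x → κ * x)
               (sym (trans (#SYT≡#Std (replicate b a)) (cong (λ N → #Std N (replicate b a)) (sum-replicate b a)))))) ⟩
        sf k * ρ * (κ * f) * ka! * kb! * M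
          ≡⟨ collect (sf k) ρ κ f ka! kb! M ⟩
        sf k * f * ka! * kb! * M * (ρ * κ)
          ≡⟨ cong (λ x → sf k * f * ka! * kb! * M * x) (sym κ′≡ρκ) ⟩
        sf k * f * ka! * kb! * M * κ′ ∎

    m : ℕ
    m = k ℕ.+ b

    target-product : + #SYT target * + ((a ℕ.* m) !)
      ≡ ka! * ba! * M * (+ #SYT (replicate a m) * + #SYT (replicate k b))
    target-product = ℤ.*-cancelʳ-≡ (+ #SYT target * + ((a ℕ.* m) !))
      (ka! * ba! * M * (+ #SYT (replicate a m) * + #SYT (replicate k b))) (sf (k ℕ.+ A) * sf m)
      {{ℤ.i*j≢0 (sf (k ℕ.+ A)) (sf m) {{sf-nonZero (k ℕ.+ A)}} {{sf-nonZero m}}}} (begin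
      + #SYT target * am! * (sf (k ℕ.+ A) * sf m)
        ≡⟨ rearrange₁ (+ #SYT target) am! (sf (k ℕ.+ A)) (sf m) ⟩
      + #SYT target * sf (k ℕ.+ A) * (am! * sf m)
        ≡⟨ cong (_* (am! * sf m)) target-count ⟩
      sf k * (ba! * sf b * sf a) * ka! * kb! * M * (am! * sf m)
        ≡⟨ rearrange₂ (sf k) ba! (sf b) (sf a) ka! kb! M am! (sf m) ⟩
      ka! * ba! * M * ((am! * sf a * sf m) * (kb! * sf k * sf b))
        -- The superfactorials regroup into the formulas of the two rectangles in the statement:
        -- `a + m` equals `k + A`, and `k + b` is `m`.
        ≡⟨ cong₂ (λ x y → ka! * ba! * M * (x * y))
             (trans (sym (rectangle a m)) (cong (λ j → f₁ * sf j) (commute a k b)))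
             (sym (rectangle k b)) ⟩
      ka! * ba! * M * ((f₁ * sf (k ℕ.+ A)) * (f₂ * sf m))
        ≡⟨ rearrange₃ (ka! * ba! * M) f₁ (sf (k ℕ.+ A)) f₂ (sf m) ⟩
      ka! * ba! * M * (f₁ * f₂) * (sf (k ℕ.+ A) * sf m) ∎)
      where
      am! = + ((a ℕ.* m) !)
      f₁ = + #SYT (replicate a m)
      f₂ = + #SYT (replicate k b)
      commute : ∀ a k b → a ℕ.+ (k ℕ.+ b) ≡ k ℕ.+ (b ℕ.+ a)
      commute = ℕ-Ring.solve-∀
      rearrange₁ : ∀ t m x y → t * m * (x * y) ≡ t * x * (m * y)
      rearrange₁ = solve-∀
      rearrange₂ : ∀ k p b a x y m q s →
        k * (p * b * a) * x * y * m * (q * s) ≡ x * p * m * ((q * a * s) * (y * k * b))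
      rearrange₂ = solve-∀
      rearrange₃ : ∀ e f x g y → e * ((f * x) * (g * y)) ≡ e * (f * g) * (x * y)
      rearrange₃ = solve-∀

  module _ (a b k′ : ℕ) where
    open Sums a b k′ using (k; n)
    open Count a b k′ using (target; m; target-product)

    private
      fa fb U V : ℕ
      fa = #SYT (replicate a m)
      fb = #SYT (replicate k b)
      U  = (a ℕ.* m ℕ.+ suc (k ℕ.* b)) C (a ℕ.* m)
      V  = (k ℕ.* a ℕ.+ suc (k ℕ.* b)) C (k ℕ.* a)

    truncated-binomials : #SYT target ℕ.* V ≡ U ℕ.* fa ℕ.* fb
    truncated-binomials = ℕ.*-cancelʳ-≡ (#SYT target ℕ.* V) (U ℕ.* fa ℕ.* fb) (am! ℕ.* kb!) {{ℕ.m*n≢0 am! kb! {{(a ℕ.* m) ℕ.!≢0}} {{suc (k ℕ.* b) ℕ.!≢0}}}} (begin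
      #SYT target ℕ.* V ℕ.* (am! ℕ.* kb!)
        ≡⟨ rearrange₁ (#SYT target) V am! kb! ⟩
      #SYT target ℕ.* am! ℕ.* (V ℕ.* kb!)
        ≡⟨ cong (ℕ._* (V ℕ.* kb!)) product ⟩
      ka! ℕ.* ba! ℕ.* mc′ ℕ.* (fa ℕ.* fb) ℕ.* (V ℕ.* kb!)
        ≡⟨ rearrange₂ ka! ba! mc′ (fa ℕ.* fb) V kb! ⟩
      mc′ ℕ.* (V ℕ.* (ka! ℕ.* kb!) ℕ.* ba!) ℕ.* (fa ℕ.* fb)
        ≡⟨ cong (λ x → mc′ ℕ.* (x ℕ.* ba!) ℕ.* (fa ℕ.* fb)) (trans (C-! (k ℕ.* a) (suc (k ℕ.* b))) (cong _! (ℕ.+-suc (k ℕ.* a) (k ℕ.* b)))) ⟩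
      mc′ ℕ.* (suc (k ℕ.* a ℕ.+ k ℕ.* b) ! ℕ.* ba!) ℕ.* (fa ℕ.* fb)
        -- The factorial of the convolution and the one in the numerator of `U` agree: both belong
        -- to the number of boxes of the truncated shape.
        ≡⟨ cong (ℕ._* (fa ℕ.* fb)) (trans (multichoose-! (suc (k ℕ.* a ℕ.+ k ℕ.* b)) (b ℕ.* a)) (trans (cong _! (size k a b)) (sym (C-! (a ℕ.* m) (suc (k ℕ.* b)))))) ⟩
      U ℕ.* (am! ℕ.* kb!) ℕ.* (fa ℕ.* fb)
        ≡⟨ rearrange₃ U (am! ℕ.* kb!) fa fb ⟩
      U ℕ.* fa ℕ.* fb ℕ.* (am! ℕ.* kb!) ∎)
      where
      am! = (a ℕ.* m) !
      kb! = suc (k ℕ.* b) !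
      ka! = (k ℕ.* a) !
      ba! = (b ℕ.* a) !
      mc′ = multichoose (suc (k ℕ.* a ℕ.+ k ℕ.* b)) (b ℕ.* a)
      product : #SYT target ℕ.* am! ≡ ka! ℕ.* ba! ℕ.* mc′ ℕ.* (fa ℕ.* fb)
      product = ℤ.+-injective (trans (ℤ.pos-* (#SYT target) am!) (trans target-product (sym
        (trans (ℤ.pos-* (ka! ℕ.* ba! ℕ.* mc′) (fa ℕ.* fb)) (cong₂ _*_
          (trans (ℤ.pos-* (ka! ℕ.* ba!) mc′) (cong (_* + mc′) (ℤ.pos-* ka! ba!)))
          (ℤ.pos-* fa fb))))))
      size : ∀ k a b → suc (k ℕ.* a ℕ.+ k ℕ.* b) ℕ.+ b ℕ.* a ≡ a ℕ.* (k ℕ.+ b) ℕ.+ suc (k ℕ.* b)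
      size = ℕ-Ring.solve-∀
      rearrange₁ : ∀ t v x y → t ℕ.* v ℕ.* (x ℕ.* y) ≡ t ℕ.* x ℕ.* (v ℕ.* y)
      rearrange₁ = ℕ-Ring.solve-∀
      rearrange₂ : ∀ x y z f v w → x ℕ.* y ℕ.* z ℕ.* f ℕ.* (v ℕ.* w) ≡ z ℕ.* (v ℕ.* (x ℕ.* w) ℕ.* y) ℕ.* f
      rearrange₂ = ℕ-Ring.solve-∀
      rearrange₃ : ∀ u x f g → u ℕ.* x ℕ.* (f ℕ.* g) ≡ u ℕ.* f ℕ.* g ℕ.* x
      rearrange₃ = ℕ-Ring.solve-∀

-- Passage to the truncated rectangle of the statement

⧹-[] : ∀ s → s ⧹ [] ≡ s
⧹-[] []      = refl
⧹-[] (_ ∷ _) = refl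

rectangle-⧹ : ∀ j b n k l → replicate (suc (j ℕ.+ b)) n ⧹ (replicate j k ++ [ l ])
  ≡ replicate j (n ℕ.∸ k) ++ (n ℕ.∸ l) ∷ replicate b n
rectangle-⧹ zero    b n k l = cong (n ℕ.∸ l ∷_) (⧹-[] (replicate b n))
rectangle-⧹ (suc j) b n k l = cong (n ℕ.∸ k ∷_) (rectangle-⧹ j b n k l)

open import Data.Nat.Base using (_+_; _*_; _∸_)

-- Stated for variables, so that matching on `refl` replaces all arguments at once.
transport : ∀ {s s′ t t′ u u′ N N′ p p′ M M′ q q′} →
  s ≡ s′ → N ≡ N′ → p ≡ p′ → M ≡ M′ → q ≡ q′ → t ≡ t′ → u ≡ u′ →
  #SYT s′ * (N′ C p′) ≡ (M′ C q′) * #SYT t′ * #SYT u′ →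
  #SYT s * (N C p) ≡ (M C q) * #SYT t * #SYT u
transport refl refl refl refl refl refl refl eq = eq

m+n≡o⇒o∸m≡n : ∀ i {j o} → o ≡ i + j → o ∸ i ≡ j
m+n≡o⇒o∸m≡n i {j} eq = trans (cong (_∸ i) eq) (ℕ.m+n∸m≡n i j)

-- The sides stay variables tied by equations, which gives the ring solver goals in `k` itself and
-- avoids a case split on `k`.
truncated-rectangle : ∀ a b k′ n m k → k ≡ suc k′ → n ≡ k + a → m ≡ k + b →
  #SYT (replicate m n ⧹ (replicate k′ k ++ [ k′ ])) * ((k * (m + n ∸ 2 * k) + 1) C (k * n ∸ k * k))
  ≡ ((n * m ∸ k * k + 1) C (m * (n ∸ k))) * #SYT (replicate (n ∸ k) m) * #SYT (replicate k (m ∸ k))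
truncated-rectangle a b k′ n m k k≡ n≡ m≡ = transport
  diagram
  (trans (cong (λ i → k * i + 1) (m+n≡o⇒o∸m≡n (2 * k) (trans (cong₂ _+_ m≡ n≡) (total k a b)))) (last-suc k a b))
  (m+n≡o⇒o∸m≡n (k * k) (trans (cong (k *_) n≡) (distrib k a)))
  (trans (cong (λ i → i + 1) (m+n≡o⇒o∸m≡n (k * k) (trans (cong₂ _*_ n≡ m≡) (expand k a b)))) (add-one (a * (k + b)) (k * b)))
  (trans (cong₂ _*_ m≡ n∸k≡a) (ℕ.*-comm (k + b) a))
  (cong₂ replicate n∸k≡a m≡)
  (cong (replicate k) (m+n≡o⇒o∸m≡n k m≡))
  (specialise k≡ (truncated-binomials a b k′))
  where
  specialise : ∀ {k} → k ≡ suc k′ →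
    #SYT (replicate k′ a ++ suc a ∷ replicate b (suc k′ + a)) * ((suc k′ * a + suc (suc k′ * b)) C (suc k′ * a))
      ≡ ((a * (suc k′ + b) + suc (suc k′ * b)) C (a * (suc k′ + b))) * #SYT (replicate a (suc k′ + b)) * #SYT (replicate (suc k′) b) →
    #SYT (replicate k′ a ++ suc a ∷ replicate b (k + a)) * ((k * a + suc (k * b)) C (k * a))
      ≡ ((a * (k + b) + suc (k * b)) C (a * (k + b))) * #SYT (replicate a (k + b)) * #SYT (replicate k b)
  specialise refl eq = eq
  n∸k≡a : n ∸ k ≡ a
  n∸k≡a = m+n≡o⇒o∸m≡n k n≡
  n∸k′≡1+a : n ∸ k′ ≡ suc a
  n∸k′≡1+a = m+n≡o⇒o∸m≡n k′ (trans n≡ (trans (cong (_+ a) k≡) (sym (ℕ.+-suc k′ a))))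
  diagram : replicate m n ⧹ (replicate k′ k ++ [ k′ ]) ≡ replicate k′ a ++ suc a ∷ replicate b (k + a)
  diagram = trans (cong (λ i → replicate i n ⧹ (replicate k′ k ++ [ k′ ])) (trans m≡ (cong (_+ b) k≡)))
    (trans (rectangle-⧹ k′ b n k k′) (cong₂ _++_ (cong (replicate k′) n∸k≡a)
      (cong₂ _∷_ n∸k′≡1+a (cong (replicate b) n≡))))
  distrib : ∀ k a → k * (k + a) ≡ k * k + k * a
  distrib = ℕ-Ring.solve-∀
  total : ∀ k a b → k + b + (k + a) ≡ 2 * k + (a + b)
  total = ℕ-Ring.solve-∀
  expand : ∀ k a b → (k + a) * (k + b) ≡ k * k + (a * (k + b) + k * b)
  expand = ℕ-Ring.solve-∀
  last-suc : ∀ k a b → k * (a + b) + 1 ≡ k * a + suc (k * b)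
  last-suc = ℕ-Ring.solve-∀
  add-one : ∀ x y → x + y + 1 ≡ x + suc y
  add-one = ℕ-Ring.solve-∀

theorem3 : (n m k : ℕ) → 0 < n → 0 < m → 0 < k → k ≤ n → (k≤m : k ≤ m) →
    (+ #SYT (replicate m n ⧹ (replicate (k ∸ 1) k ++ [ k ∸ 1 ]))) / 1
    ≡ _/_ (+ (((n * m ∸ k * k + 1) C (m * (n ∸ k)))
    * #SYT (replicate (n ∸ k) m) * #SYT (replicate k (m ∸ k))))
    ((k * (m + n ∸ 2 * k) + 1) C (k * n ∸ k * k))
    {{denominator-nonZero {n} {m} {k} k≤m}}
theorem3 n m k _ _ 0<k k≤n k≤m =
  /1≡/ (#SYT (replicate m n ⧹ (replicate (k ∸ 1) k ++ [ k ∸ 1 ])))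
    (((n * m ∸ k * k + 1) C (m * (n ∸ k))) * #SYT (replicate (n ∸ k) m) * #SYT (replicate k (m ∸ k)))
    ((k * (m + n ∸ 2 * k) + 1) C (k * n ∸ k * k))
    {{denominator-nonZero {n} {m} {k} k≤m}}
    (truncated-rectangle (n ∸ k) (m ∸ k) (k ∸ 1) n m k (sym (ℕ.m+[n∸m]≡n 0<k))
      (sym (ℕ.m+[n∸m]≡n k≤n)) (sym (ℕ.m+[n∸m]≡n k≤m)))
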